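{- Let $m \geq 1$ be an integer and let $n$ be an even integer with $n \geq 2^m$. Then the hypercube $Q_n$ can be decomposed into cycles of length $2^m n$; that is, the edge set of $Q_n$ can be partitioned into the edge sets of cycles each having exactly $2^m n$ edges.
   Context: $Q_n$ is the $n$-dimensional hypercube: its vertices are the binary $n$-tuples (equivalently the subsets of $\{1,\dots,n\}$), and two vertices are adjacent iff they differ in exactly one coordinate. A decomposition of a graph $G$ is a collection of edge-disjoint subgraphs whose union contains every edge of $G$ exactly once; "$G$ decomposes into $k$-cycles" means such a collection in which every member is a cycle with $k$ edges. -}

module Defs where

open import Data.Nat using (ℕ; zero; suc; _≤_)
open import Data.Nat.DivMod using (_mod_)
open import Data.Bool using (Bool; true; false)
open import Data.Fin using (Fin; toℕ)
open import Data.Vec using (Vec; []; _∷_)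
open import Data.Product using (Σ; _×_; _,_)
open import Data.Sum using (_⊎_)
open import Function.Definitions using (Injective)
open import Relation.Binary.PropositionalEquality using (_≡_)
open import Relation.Nullary using (¬_)

Vertex : ℕ → Set
Vertex n = Vec Bool n

hamming : ∀ {n} → Vertex n → Vertex n → ℕ
hamming [] [] = 0
hamming (true ∷ u) (true ∷ v) = hamming u v
hamming (false ∷ u) (false ∷ v) = hamming u v
hamming (true ∷ u) (false ∷ v) = suc (hamming u v)
hamming (false ∷ u) (true ∷ v) = suc (hamming u v)

Adjacent : ∀ {n} → Vertex n → Vertex n → Set
Adjacent u v = hamming u v ≡ 1

cnext : ∀ {k} → Fin k → Fin k
cnext {suc k} j = suc (toℕ j) mod suc k

record Cycle (n L : ℕ) : Set where
  field
    length≥3 : 3 ≤ L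
    vert     : Fin L → Vertex n
    distinct : Injective _≡_ _≡_ vert
    adjacent : ∀ j → Adjacent (vert j) (vert (cnext j))
open Cycle public

EdgeAt : ∀ {n L} → Cycle n L → Fin L → Vertex n → Vertex n → Set
EdgeAt C j u v =
  (vert C j ≡ u × vert C (cnext j) ≡ v) ⊎ (vert C j ≡ v × vert C (cnext j) ≡ u)

record Decomposition (n L : ℕ) : Set where
  field
    t      : ℕ
    cycles : Fin t → Cycle n L
    covers : ∀ (u v : Vertex n) → Adjacent u v →
             Σ (Fin t) (λ i → Σ (Fin L) (λ j → EdgeAt (cycles i) j u v))
    unique : ∀ (u v : Vertex n) (i i′ : Fin t) (j j′ : Fin L) →
             EdgeAt (cycles i) j u v → EdgeAt (cycles i′) j′ u v →
             (i ≡ i′ × j ≡ j′)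

DecomposesIntoCycles : ℕ → ℕ → Set
DecomposesIntoCycles n L = Decomposition n L

{-# OPTIONS --safe #-}
module Submission where

-- All cycles are taken to be translates, by a set S of vertices, of one closed walk T
-- in Q_n.  Some vertices of T are marked, so that the translates of the marked ones
-- meet every vertex once.  Then four further coordinates a, a′, b, b′ (0 … 3) yield
-- the same situation for (m + 1 , n + 4): follow T, making the detour a a′ (in
-- alternating order) at each marked vertex but the first; cross by a; follow T again
-- with detours b b′; return by b, a′, b′.  Translates range over S times the even
-- vectors of length 4, so only the parity of the new coordinates (the "layer")
-- matters for counting edges.  The induction starts at m = 1, from the walk that
-- flips the coordinates 1 … n in order, twice; this misses n = 4(m - 1), which is
-- reached from an explicit Hamiltonian decomposition of Q_4.  "Exactly once" is always
-- expressed as a sum of indicators being equal to 1.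

open import Defs
open import Data.Bool as Bool using (Bool; true; false; not; _xor_)
open import Data.Bool.Properties using (not-involutive; not-injective)
open import Data.Fin using (Fin; zero; suc; toℕ; _↑ˡ_; _↑ʳ_; join; splitAt)
open import Data.Fin.Patterns using (0F; 1F; 2F; 3F)
open import Data.Fin.Properties using (join-splitAt; all?; toℕ-fromℕ<; toℕ<n)
open import Data.Fin.Subset.Properties using (anySubset?)
open import Data.List using (List; []; _∷_; _++_; map; concatMap; length; lookup; take)
open import Data.List.Properties using (length-map; length-++; take-all)
open import Data.Nat using (ℕ; zero; suc; _+_; _*_; _^_; _∸_; _≤_; z≤n; s≤s)
open import Data.Nat.Divisibility using (_∣_; divides)
open import Data.Nat.ListAction using (sum)
open import Data.Nat.DivMod using (_%_; m%n<n; m<n⇒m%n≡m; n%n≡0)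
open import Data.Nat.Properties
open import Algebra.Properties.CommutativeMonoid.Sum +-0-commutativeMonoid
  using (sum-cong-≗; ∑-distrib-+) renaming (sum to ∑)
open import Data.Nat.Tactic.RingSolver using (solve-∀)
open import Data.Product using (Σ; ∃; _×_; _,_; proj₁; proj₂; map₂)
open import Data.Sum using (_⊎_; inj₁; inj₂)
open import Data.Vec as Vec using ([]; _∷_; updateAt)
open import Data.Vec.Properties using (≡-dec; ∷-injectiveˡ; ∷-injectiveʳ)
open import Function using (_∘_)
open import Relation.Nullary using (Dec; ¬?; contradiction)
open import Relation.Nullary.Decidable using (map′; from-yes; decidable-stable)
open import Relation.Binary.PropositionalEquality hiding (J)
open ≤-Reasoning

-- Summing over the even vectors, each step of a walk counts once for every vector of one parity.
-- Old edges occur in both layers, so T has to be followed exactly twice, once per layer. A new edge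
-- has one end in each layer, so over each u every new direction must be used exactly once. The
-- marks hand out this duty: u is marked once among the translates, and its marked visits supply a
-- and a′ in the even pass, b and b′ in the odd pass. The first marked vertex spends its four edges
-- on connecting the two passes instead. If there are r starts, then r · 2^m · n = n · 2^(n - 1) and
-- r · marks = 2^n force 2^(m + 1) marks, and 2 · 2^m · n + 4 · 2^(m + 1) = 2^(m + 1) · (n + 4) is
-- the required length. What parity cannot see is whether the new walk repeats a vertex; this
-- dictates the alternation of the detours and the choice of the connecting directions.

private variable
  m n N : ℕ
  A B : Set

-- Coordinate flips and indicator functions.

flip : Fin n → Vertex n → Vertex n
flip d v = updateAt v d not

flip-involutive : (d : Fin n) (v : Vertex n) → flip d (flip d v) ≡ v
flip-involutive zero    (x ∷ v) = cong (_∷ v) (not-involutive x)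
flip-involutive (suc d) (x ∷ v) = cong (x ∷_) (flip-involutive d v)

flip-comm : (d e : Fin n) (v : Vertex n) → flip d (flip e v) ≡ flip e (flip d v)
flip-comm zero    zero    (x ∷ v) = refl
flip-comm zero    (suc e) (x ∷ v) = refl
flip-comm (suc d) zero    (x ∷ v) = refl
flip-comm (suc d) (suc e) (x ∷ v) = cong (x ∷_) (flip-comm d e v)

flip-↑ˡ : (i : Fin N) (k : Vertex N) (u : Vertex n) →
          flip (i ↑ˡ n) (k Vec.++ u) ≡ flip i k Vec.++ u
flip-↑ˡ zero    (x ∷ k) u = refl
flip-↑ˡ (suc i) (x ∷ k) u = cong (x ∷_) (flip-↑ˡ i k u)

flip-↑ʳ : (d : Fin n) (k : Vertex N) (u : Vertex n) →
          flip (N ↑ʳ d) (k Vec.++ u) ≡ k Vec.++ flip d u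
flip-↑ʳ d []      u = refl
flip-↑ʳ d (x ∷ k) u = cong (x ∷_) (flip-↑ʳ d k u)

eq : Bool → Bool → ℕ
eq false false = 1
eq false true  = 0
eq true  false = 0
eq true  true  = 1

eq-exclusive : ∀ y → eq false y + eq true y ≡ 1
eq-exclusive false = refl
eq-exclusive true  = refl

eq-total : ∀ x → eq x false + eq x true ≡ 1
eq-total false = refl
eq-total true  = refl

δ : Vertex n → Vertex n → ℕ
δ []      []      = 1
δ (x ∷ u) (y ∷ v) = eq x y * δ u v

δF : Fin n → Fin n → ℕ
δF zero    zero    = 1
δF zero    (suc _) = 0
δF (suc _) zero    = 0
δF (suc i) (suc j) = δF i j

δ-++ : (k κ : Vertex N) (u s : Vertex n) → δ (k Vec.++ u) (κ Vec.++ s) ≡ δ k κ * δ u s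
δ-++ []      []      u s = sym (*-identityˡ _)
δ-++ (x ∷ k) (y ∷ κ) u s = trans (cong (eq x y *_) (δ-++ k κ u s)) (sym (*-assoc (eq x y) _ _))

δF-inner : (i j : Fin N) → δF (i ↑ˡ n) (j ↑ˡ n) ≡ δF i j
δF-inner zero    zero    = refl
δF-inner zero    (suc j) = refl
δF-inner (suc i) zero    = refl
δF-inner (suc i) (suc j) = δF-inner i j

δF-outer : ∀ N (d e : Fin n) → δF (N ↑ʳ d) (N ↑ʳ e) ≡ δF d e
δF-outer zero    d e = refl
δF-outer (suc N) d e = δF-outer N d e

δF-inner-outer : (i : Fin N) (d : Fin n) → δF (i ↑ˡ n) (N ↑ʳ d) ≡ 0
δF-inner-outer zero    d = refl
δF-inner-outer (suc i) d = δF-inner-outer i d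

δF-outer-inner : (d : Fin n) (i : Fin N) → δF (N ↑ʳ d) (i ↑ˡ n) ≡ 0
δF-outer-inner d zero    = refl
δF-outer-inner d (suc i) = δF-outer-inner d i

-- Walks, weighted tallies and tours.

Step : ℕ → Set
Step n = Bool × Fin n

dirIs : Fin n → Step n → ℕ
dirIs e (_ , d) = δF e d

isMarked : Bool × A → ℕ
isMarked (false , _) = 0
isMarked (true  , _) = 1

always : Step n → ℕ
always _ = 1

end : Vertex n → List (Step n) → Vertex n
end s []            = s
end s ((_ , d) ∷ T) = end (flip d s) T

-- Weighs departures from `u`: the last vertex is left out, so a closed walk does not count its
-- starting point twice. An edge is seen only from the end where its traversal begins, which is why
-- edge conditions add the tallies of both ends.
tally : (Step n → ℕ) → Vertex n → Vertex n → List (Step n) → ℕ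
tally g u s []      = 0
tally g u s (t ∷ T) = δ u s * g t + tally g u (flip (proj₂ t) s) T

total : (A → ℕ) → List A → ℕ
total f S = sum (map f S)

marks : List (Bool × A) → ℕ
marks = total isMarked

end-flip : (d : Fin n) (s : Vertex n) (T : List (Step n)) → end (flip d s) T ≡ flip d (end s T)
end-flip d s []            = refl
end-flip d s ((_ , e) ∷ T) = trans (cong (λ v → end v T) (flip-comm e d s)) (end-flip d (flip e s) T)

-- Flips commute, so a second run cancels every flip of the first. This closes the walk of two laps.
end-involutive : (s : Vertex n) (T : List (Step n)) → end (end s T) T ≡ s
end-involutive s []            = refl
end-involutive s ((_ , d) ∷ T) =
  trans (end-flip d (end (flip d s) T) T)
    (trans (cong (flip d) (end-involutive (flip d s) T)) (flip-involutive d s))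

total-cong : {f g : A → ℕ} → (∀ x → f x ≡ g x) → ∀ S → total f S ≡ total g S
total-cong h []      = refl
total-cong h (x ∷ S) = cong₂ _+_ (h x) (total-cong h S)

total-+ : ∀ (f g : A → ℕ) S → total (λ x → f x + g x) S ≡ total f S + total g S
total-+ f g []      = refl
total-+ f g (x ∷ S) = trans (cong (f x + g x +_) (total-+ f g S)) (lemma (f x) (g x) _ _)
  where
  lemma : ∀ a b c d → a + b + (c + d) ≡ a + c + (b + d)
  lemma = solve-∀

total-*ʳ : ∀ (f : A → ℕ) c S → total (λ x → f x * c) S ≡ total f S * c
total-*ʳ f c []      = refl
total-*ʳ f c (x ∷ S) = trans (cong (f x * c +_) (total-*ʳ f c S)) (sym (*-distribʳ-+ c (f x) _))

total-0 : ∀ (S : List A) → total (λ _ → 0) S ≡ 0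
total-0 []      = refl
total-0 (_ ∷ S) = total-0 S

total-++ : ∀ (f : A → ℕ) S T → total f (S ++ T) ≡ total f S + total f T
total-++ f []      T = refl
total-++ f (x ∷ S) T = trans (cong (f x +_) (total-++ f S T)) (sym (+-assoc (f x) _ _))

total-map : ∀ (f : B → ℕ) (h : A → B) S → total f (map h S) ≡ total (f ∘ h) S
total-map f h []      = refl
total-map f h (x ∷ S) = cong (f (h x) +_) (total-map f h S)

total-concatMap : ∀ (f : B → ℕ) (h : A → List B) S →
                  total f (concatMap h S) ≡ total (λ x → total f (h x)) S
total-concatMap f h []      = refl
total-concatMap f h (x ∷ S) = trans (total-++ f (h x) _) (cong (total f (h x) +_) (total-concatMap f h S))

-- `first` is kept apart from `rest` so that the leading mark, where the two passes will be
-- connected, is there by construction. `simple` speaks of the origin only, because the walk from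
-- any other start is a translate.
record Tour (m n : ℕ) : Set where
  field
    starts : List (Vertex n)
    first  : Fin n
    rest   : List (Step n)
  walk : List (Step n)
  walk = (true , first) ∷ rest
  field
    length-walk : length walk ≡ 2 ^ m * n
    marks-walk  : marks walk ≡ 2 ^ suc m
    edges-once  : ∀ u e → total (λ s → tally (dirIs e) u s walk) starts
                        + total (λ s → tally (dirIs e) (flip e u) s walk) starts ≡ 1
    marked-once : ∀ u → total (λ s → tally isMarked u s walk) starts ≡ 1
    closed      : ∀ s → end s walk ≡ s
    simple      : ∀ u → tally always u (Vec.replicate n false) walk ≤ 1

-- Parity classes and the reduction of tallies to two layers.

parity : Vertex n → Bool
parity []      = false
parity (x ∷ v) = x xor parity v

parity-flip : (d : Fin n) (v : Vertex n) → parity (flip d v) ≡ not (parity v)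
parity-flip zero (false ∷ v) = refl
parity-flip zero (true  ∷ v) = sym (not-involutive (parity v))
parity-flip (suc d) (false ∷ v) = parity-flip d v
parity-flip (suc d) (true  ∷ v) = cong not (parity-flip d v)

parityClass : ∀ N → Bool → List (Vertex N)
parityClass zero    false = [] ∷ []
parityClass zero    true  = []
parityClass (suc N) b     =
  map (false ∷_) (parityClass N b) ++ map (true ∷_) (parityClass N (not b))

total-parityClass-suc : ∀ (f : Vertex (suc N) → ℕ) b →
  total f (parityClass (suc N) b) ≡
    total (f ∘ (false ∷_)) (parityClass N b) + total (f ∘ (true ∷_)) (parityClass N (not b))
total-parityClass-suc {N} f b =
  trans (total-++ f (map (false ∷_) (parityClass N b)) _)
        (cong₂ _+_ (total-map f (false ∷_) (parityClass N b)) (total-map f (true ∷_) (parityClass N (not b))))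

total-δ-parityClass : ∀ (k : Vertex N) b → total (δ k) (parityClass N b) ≡ eq (parity k) b
total-δ-parityClass [] false = refl
total-δ-parityClass [] true  = refl
total-δ-parityClass {suc N} (false ∷ k) b = begin-equality
  total (δ (false ∷ k)) (parityClass (suc N) b)
    ≡⟨ total-parityClass-suc (δ (false ∷ k)) b ⟩
  total (λ s → 1 * δ k s) (parityClass N b) + total (λ s → 0) (parityClass N (not b))
    ≡⟨ cong₂ _+_ (total-cong (λ s → *-identityˡ (δ k s)) (parityClass N b)) (total-0 (parityClass N (not b))) ⟩
  total (δ k) (parityClass N b) + 0
    ≡⟨ +-identityʳ _ ⟩
  total (δ k) (parityClass N b)
    ≡⟨ total-δ-parityClass k b ⟩
  eq (parity k) b ∎
total-δ-parityClass {suc N} (true ∷ k) b = begin-equality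
  total (δ (true ∷ k)) (parityClass (suc N) b)
    ≡⟨ total-parityClass-suc (δ (true ∷ k)) b ⟩
  total (λ s → 0) (parityClass N b) + total (λ s → 1 * δ k s) (parityClass N (not b))
    ≡⟨ cong₂ _+_ (total-0 (parityClass N b)) (total-cong (λ s → *-identityˡ (δ k s)) (parityClass N (not b))) ⟩
  total (δ k) (parityClass N (not b))
    ≡⟨ total-δ-parityClass k (not b) ⟩
  eq (parity k) (not b)
    ≡⟨ eq-not (parity k) b ⟩
  eq (not (parity k)) b ∎
  where
  eq-not : ∀ x y → eq x (not y) ≡ eq (not x) y
  eq-not false false = refl
  eq-not false true  = refl
  eq-not true  false = refl
  eq-not true  true  = refl

total-flip : ∀ (f : Vertex N → ℕ) d b →
             total (f ∘ flip d) (parityClass N b) ≡ total f (parityClass N (not b))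
total-flip {suc N} f zero b = begin-equality
  total (f ∘ flip zero) (parityClass (suc N) b)
    ≡⟨ total-parityClass-suc (f ∘ flip zero) b ⟩
  total (f ∘ (true ∷_)) (parityClass N b) + total (f ∘ (false ∷_)) (parityClass N (not b))
    ≡⟨ +-comm (total (f ∘ (true ∷_)) (parityClass N b)) _ ⟩
  total (f ∘ (false ∷_)) (parityClass N (not b)) + total (f ∘ (true ∷_)) (parityClass N b)
    ≡⟨ cong (λ c → total (f ∘ (false ∷_)) (parityClass N (not b)) + total (f ∘ (true ∷_)) (parityClass N c)) (sym (not-involutive b)) ⟩
  total (f ∘ (false ∷_)) (parityClass N (not b)) + total (f ∘ (true ∷_)) (parityClass N (not (not b)))
    ≡⟨ sym (total-parityClass-suc f (not b)) ⟩
  total f (parityClass (suc N) (not b)) ∎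
total-flip {suc N} f (suc d) b = begin-equality
  total (f ∘ flip (suc d)) (parityClass (suc N) b)
    ≡⟨ total-parityClass-suc (f ∘ flip (suc d)) b ⟩
  total (f ∘ (false ∷_) ∘ flip d) (parityClass N b) + total (f ∘ (true ∷_) ∘ flip d) (parityClass N (not b))
    ≡⟨ cong₂ _+_ (total-flip (f ∘ (false ∷_)) d b) (total-flip (f ∘ (true ∷_)) d (not b)) ⟩
  total (f ∘ (false ∷_)) (parityClass N (not b)) + total (f ∘ (true ∷_)) (parityClass N (not (not b)))
    ≡⟨ sym (total-parityClass-suc f (not b)) ⟩
  total f (parityClass (suc N) (not b)) ∎

SplitStep : ℕ → ℕ → Set
SplitStep N n = Bool × (Fin N ⊎ Fin n)

joinStep : SplitStep N n → Step (N + n)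
joinStep = map₂ (join _ _)

-- The tally of the image of a walk under (k , u) ↦ (parity k , u): every inner direction
-- switches between the two layers.
layer : (SplitStep N n → ℕ) → Bool → Vertex n → Bool → Vertex n → List (SplitStep N n) → ℕ
layer g p u b s []               = 0
layer g p u b s (t@(_ , inj₁ _) ∷ R) = eq p b * (δ u s * g t) + layer g p u (not b) s R
layer g p u b s (t@(_ , inj₂ d) ∷ R) = eq p b * (δ u s * g t) + layer g p u b (flip d s) R

-- A flip of a new coordinate carries one parity class bijectively onto the other, and a class
-- contains `k` exactly when the parity fits. So a sum over a class forgets everything about `k` but
-- its parity.
total-tally-layer : ∀ (g : Step (N + n) → ℕ) (k : Vertex N) u b s R →
  total (λ κ → tally g (k Vec.++ u) (κ Vec.++ s) (map joinStep R)) (parityClass N b)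
    ≡ layer (g ∘ joinStep) (parity k) u b s R
total-tally-layer {N} g k u b s [] = total-0 (parityClass N b)
total-tally-layer {N} {n} g k u b s (t@(_ , d) ∷ R) = begin-equality
  total (λ κ → δ (k Vec.++ u) (κ Vec.++ s) * g (joinStep t) + next κ) K
    ≡⟨ total-+ _ next K ⟩
  total (λ κ → δ (k Vec.++ u) (κ Vec.++ s) * g (joinStep t)) K + total next K
    ≡⟨ cong (_+ total next K) (begin-equality
       total (λ κ → δ (k Vec.++ u) (κ Vec.++ s) * g (joinStep t)) K
         ≡⟨ total-cong (λ κ → trans (cong (_* g (joinStep t)) (δ-++ k κ u s)) (*-assoc (δ k κ) _ _)) K ⟩
       total (λ κ → δ k κ * (δ u s * g (joinStep t))) K
         ≡⟨ total-*ʳ (δ k) _ K ⟩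
       total (δ k) K * (δ u s * g (joinStep t))
         ≡⟨ cong (_* (δ u s * g (joinStep t))) (total-δ-parityClass k b) ⟩
       eq (parity k) b * (δ u s * g (joinStep t)) ∎) ⟩
  eq (parity k) b * (δ u s * g (joinStep t)) + total next K
    ≡⟨ tail d ⟩
  layer (g ∘ joinStep) (parity k) u b s (t ∷ R) ∎
  where
  K = parityClass N b
  next : Vertex N → ℕ
  next κ = tally g (k Vec.++ u) (flip (join N n d) (κ Vec.++ s)) (map joinStep R)
  tail : ∀ d → eq (parity k) b * (δ u s * g (joinStep (proj₁ t , d)))
             + total (λ κ → tally g (k Vec.++ u) (flip (join N n d) (κ Vec.++ s)) (map joinStep R)) K
             ≡ layer (g ∘ joinStep) (parity k) u b s ((proj₁ t , d) ∷ R)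
  tail (inj₁ i) = cong (_ +_) (begin-equality
    total (λ κ → tally g (k Vec.++ u) (flip (i ↑ˡ n) (κ Vec.++ s)) (map joinStep R)) K
      ≡⟨ total-cong (λ κ → cong (λ v → tally g (k Vec.++ u) v (map joinStep R)) (flip-↑ˡ i κ s)) K ⟩
    total (λ κ → tally g (k Vec.++ u) (flip i κ Vec.++ s) (map joinStep R)) K
      ≡⟨ total-flip (λ κ → tally g (k Vec.++ u) (κ Vec.++ s) (map joinStep R)) i b ⟩
    total (λ κ → tally g (k Vec.++ u) (κ Vec.++ s) (map joinStep R)) (parityClass N (not b))
      ≡⟨ total-tally-layer g k u (not b) s R ⟩
    layer (g ∘ joinStep) (parity k) u (not b) s R ∎)
  tail (inj₂ e) = cong (_ +_) (begin-equality
    total (λ κ → tally g (k Vec.++ u) (flip (N ↑ʳ e) (κ Vec.++ s)) (map joinStep R)) K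
      ≡⟨ total-cong (λ κ → cong (λ v → tally g (k Vec.++ u) v (map joinStep R)) (flip-↑ʳ e κ s)) K ⟩
    total (λ κ → tally g (k Vec.++ u) (κ Vec.++ flip e s) (map joinStep R)) K
      ≡⟨ total-tally-layer g k u b (flip e s) R ⟩
    layer (g ∘ joinStep) (parity k) u b (flip e s) R ∎)

spread : ∀ N → List (Vertex n) → List (Vertex (N + n))
spread N = concatMap (λ s → map (Vec._++ s) (parityClass N false))

total-spread : ∀ (g : Step (N + n) → ℕ) (k : Vertex N) u S R →
  total (λ v → tally g (k Vec.++ u) v (map joinStep R)) (spread N S)
    ≡ total (λ s → layer (g ∘ joinStep) (parity k) u false s R) S
total-spread {N} g k u S R = begin-equality
  total f (spread N S)
    ≡⟨ total-concatMap f (λ s → map (Vec._++ s) (parityClass N false)) S ⟩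
  total (λ s → total f (map (Vec._++ s) (parityClass N false))) S
    ≡⟨ total-cong (λ s → trans (total-map f (Vec._++ s) (parityClass N false))
                               (total-tally-layer g k u false s R)) S ⟩
  total (λ s → layer (g ∘ joinStep) (parity k) u false s R) S ∎
  where f = λ v → tally g (k Vec.++ u) v (map joinStep R)

marks-joinStep : (R : List (SplitStep N n)) → marks (map joinStep R) ≡ marks R
marks-joinStep []                = refl
marks-joinStep ((false , _) ∷ R) = marks-joinStep R
marks-joinStep ((true  , _) ∷ R) = cong suc (marks-joinStep R)

replicate-++ : ∀ N n → Vec.replicate {A = Bool} (N + n) false
                     ≡ Vec.replicate N false Vec.++ Vec.replicate n false
replicate-++ zero    n = refl
replicate-++ (suc N) n = cong (false ∷_) (replicate-++ N n)

-- An edge in a new direction joins the two layers over one `u`, so its condition adds both layers;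
-- an edge in an old direction stays within a layer, and the condition is imposed for each `p`.
-- Closedness and simplicity are invisible in the layers and remain conditions on actual vertices.
tourFromLayers : ∀ (S : List (Vertex n)) (d : Fin n) (R : List (SplitStep N n)) →
  let W = (true , inj₂ d) ∷ R in
  length W ≡ 2 ^ m * (N + n) → marks W ≡ 2 ^ suc m →
  (∀ u i → total (λ s → layer (dirIs (i ↑ˡ n) ∘ joinStep) false u false s W) S
         + total (λ s → layer (dirIs (i ↑ˡ n) ∘ joinStep) true  u false s W) S ≡ 1) →
  (∀ p u e → total (λ s → layer (dirIs (N ↑ʳ e) ∘ joinStep) p u false s W) S
           + total (λ s → layer (dirIs (N ↑ʳ e) ∘ joinStep) p (flip e u) false s W) S ≡ 1) →
  (∀ p u → total (λ s → layer (isMarked ∘ joinStep) p u false s W) S ≡ 1) →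
  (∀ κ s → end (κ Vec.++ s) (map joinStep W) ≡ κ Vec.++ s) →
  (∀ k u → tally always (k Vec.++ u) (Vec.replicate N false Vec.++ Vec.replicate n false)
                 (map joinStep W) ≤ 1) →
  Tour m (N + n)
tourFromLayers {n} {N} {m} S d R len mks inner outer marked cl simp = record
  { starts      = spread N S
  ; first       = N ↑ʳ d
  ; rest        = map joinStep R
  ; length-walk = trans (length-map joinStep W) len
  ; marks-walk  = trans (marks-joinStep W) mks
  ; edges-once  = λ v e → subst (EdgeOnce v) (join-splitAt N n e) (edge v (splitAt N e))
  ; marked-once = marked′
  ; closed      = closed′
  ; simple      = simple′
  }
  where
  W = (true , inj₂ d) ∷ R
  uses : Fin (N + n) → Vertex (N + n) → ℕ
  uses e v = total (λ s → tally (dirIs e) v s (map joinStep W)) (spread N S)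
  EdgeOnce : Vertex (N + n) → Fin (N + n) → Set
  EdgeOnce v e = uses e v + uses e (flip e v) ≡ 1
  edge : ∀ v e → EdgeOnce v (join N n e)
  edge v e with Vec.splitAt N v
  edge _ (inj₁ i) | k , u , refl = begin-equality
    uses (i ↑ˡ n) (k Vec.++ u) + uses (i ↑ˡ n) (flip (i ↑ˡ n) (k Vec.++ u))
      ≡⟨ cong₂ _+_ (total-spread (dirIs (i ↑ˡ n)) k u S W)
                   (trans (cong (uses (i ↑ˡ n)) (flip-↑ˡ i k u)) (total-spread (dirIs (i ↑ˡ n)) (flip i k) u S W)) ⟩
    on (parity k) + on (parity (flip i k))
      ≡⟨ cong (λ p → on (parity k) + on p) (parity-flip i k) ⟩
    on (parity k) + on (not (parity k))
      ≡⟨ either (parity k) ⟩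
    1 ∎
    where
    on : Bool → ℕ
    on p = total (λ s → layer (dirIs (i ↑ˡ n) ∘ joinStep) p u false s W) S
    either : ∀ p → on p + on (not p) ≡ 1
    either false = inner u i
    either true  = trans (+-comm (on true) (on false)) (inner u i)
  edge _ (inj₂ e) | k , u , refl =
    trans (cong₂ _+_ (total-spread (dirIs (N ↑ʳ e)) k u S W)
                     (trans (cong (uses (N ↑ʳ e)) (flip-↑ʳ e k u)) (total-spread (dirIs (N ↑ʳ e)) k (flip e u) S W)))
          (outer (parity k) u e)
  marked′ : ∀ v → total (λ s → tally isMarked v s (map joinStep W)) (spread N S) ≡ 1
  marked′ v with Vec.splitAt N v
  ... | k , u , refl = trans (total-spread isMarked k u S W) (marked (parity k) u)
  closed′ : ∀ v → end v (map joinStep W) ≡ v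
  closed′ v with Vec.splitAt N v
  ... | κ , s , refl = cl κ s
  simple′ : ∀ v → tally always v (Vec.replicate (N + n) false) (map joinStep W) ≤ 1
  simple′ v with Vec.splitAt N v
  ... | k , u , refl rewrite replicate-++ N n = simp k u

-- Detours at marked vertices.

-- A detour leaves the parity of the new coordinates fixed but changes their values, so
-- swapping i and j each time makes all detours pass through the same middle value.
weave : A → A → List (Bool × B) → List (Bool × (A ⊎ B))
weave i j []              = []
weave i j ((false , d) ∷ T) = (false , inj₂ d) ∷ weave i j T
weave i j ((true  , d) ∷ T) = (true , inj₁ i) ∷ (false , inj₁ j) ∷ (false , inj₂ d) ∷ weave j i T

length-weave : ∀ (i j : A) (T : List (Bool × B)) → length (weave i j T) ≡ length T + 2 * marks T
length-weave i j [] = refl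
length-weave i j ((false , d) ∷ T) = cong suc (length-weave i j T)
length-weave i j ((true  , d) ∷ T) =
  trans (cong (3 +_) (length-weave j i T)) (lemma (length T) (marks T))
  where
  lemma : ∀ l k → 3 + (l + 2 * k) ≡ 1 + l + 2 * (1 + k)
  lemma = solve-∀

marks-weave : ∀ (i j : A) (T : List (Bool × B)) → marks (weave i j T) ≡ marks T
marks-weave i j [] = refl
marks-weave i j ((false , d) ∷ T) = marks-weave i j T
marks-weave i j ((true  , d) ∷ T) = cong suc (marks-weave j i T)

layer-weave-++ : ∀ (g : SplitStep N n → ℕ) p u b s i j T R →
  layer g p u b s (weave i j T ++ R) ≡ layer g p u b s (weave i j T) + layer g p u b (end s T) R
layer-weave-++ g p u b s i j [] R = refl
layer-weave-++ g p u b s i j ((false , d) ∷ T) R =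
  trans (cong (_ +_) (layer-weave-++ g p u b (flip d s) i j T R)) (sym (+-assoc (eq p b * _) _ _))
layer-weave-++ g p u b s i j ((true , d) ∷ T) R
  rewrite layer-weave-++ g p u (not (not b)) (flip d s) j i T R | not-involutive b =
  lemma (eq p b * (δ u s * g (true , _))) (eq p (not b) * (δ u s * g (false , _))) (eq p b * (δ u s * g (false , _))) _ _
  where
  lemma : ∀ x y z v w → x + (y + (z + (v + w))) ≡ x + (y + (z + v)) + w
  lemma = solve-∀

-- A detour returns to layer `b` without leaving `s`, so its first step and the following old step
-- depart from the same point of the layer and their weights add up. This one hypothesis covers both
-- uses: directions are counted at the old step, while the mark has moved to the step entering the
-- detour.
layer-weave-carried : ∀ (g′ : SplitStep N n → ℕ) (g : Step n → ℕ) →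
  (∀ i → g′ (false , inj₁ i) ≡ 0) →
  (∀ d → g′ (false , inj₂ d) ≡ g (false , d)) →
  (∀ i d → g′ (true , inj₁ i) + g′ (false , inj₂ d) ≡ g (true , d)) →
  ∀ p u b s i j T → layer g′ p u b s (weave i j T) ≡ eq p b * tally g u s T
layer-weave-carried g′ g h₀ h₁ h₂ p u b s i j [] = sym (*-zeroʳ (eq p b))
layer-weave-carried g′ g h₀ h₁ h₂ p u b s i j ((false , d) ∷ T)
  rewrite layer-weave-carried g′ g h₀ h₁ h₂ p u b (flip d s) i j T | h₁ d =
  sym (*-distribˡ-+ (eq p b) _ _)
layer-weave-carried {N} {n} g′ g h₀ h₁ h₂ p u b s i j ((true , d) ∷ T)
  rewrite not-involutive b | layer-weave-carried g′ g h₀ h₁ h₂ p u b (flip d s) j i T | h₀ j | sym (h₂ i d) =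
  lemma (eq p b) (eq p (not b)) (δ u s) (g′ (true , inj₁ i)) (g′ (false , inj₂ d)) _
  where
  lemma : ∀ x y z v w t → x * (z * v) + (y * (z * 0) + (x * (z * w) + x * t)) ≡ x * (z * (v + w) + t)
  lemma = solve-∀

-- Each detour uses `i` once and `j` once. Adding both layers makes the layer of departure
-- irrelevant, and the factor is symmetric in `i` and `j`, so the alternation leaves no trace.
layer-weave-switch : ∀ (f : Fin N) (u : Vertex n) b s i j T →
  layer (dirIs (f ↑ˡ n) ∘ joinStep) false u b s (weave i j T) + layer (dirIs (f ↑ˡ n) ∘ joinStep) true u b s (weave i j T)
    ≡ (δF f i + δF f j) * tally isMarked u s T
layer-weave-switch f u b s i j [] = sym (*-zeroʳ (δF f i + δF f j))
layer-weave-switch {N} {n} f u b s i j ((false , d) ∷ T) rewrite δF-inner-outer f d =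
  trans (lemma₁ (eq false b) (eq true b) (δ u s) _ _)
    (trans (layer-weave-switch f u b (flip d s) i j T) (lemma₂ (δF f i + δF f j) (δ u s) _))
  where
  lemma₁ : ∀ x y z v w → x * (z * 0) + v + (y * (z * 0) + w) ≡ v + w
  lemma₁ = solve-∀
  lemma₂ : ∀ x z t → x * t ≡ x * (z * 0 + t)
  lemma₂ = solve-∀
layer-weave-switch {N} {n} f u b s i j ((true , d) ∷ T)
  rewrite δF-inner-outer f d | δF-inner {n = n} f i | δF-inner {n = n} f j | not-involutive b =
  trans (lemma₁ (eq false b) (eq false (not b)) (eq true b) (eq true (not b)) (δ u s) (δF f i) (δF f j) _ _)
    (trans (cong₂ _+_ (cong₂ (λ x y → x * (δ u s * δF f i) + y * (δ u s * δF f j)) (eq-exclusive b) (eq-exclusive (not b)))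
                      (layer-weave-switch f u b (flip d s) j i T))
           (lemma₂ (δF f i) (δF f j) (δ u s) _))
  where
  lemma₁ : ∀ x x′ y y′ z i j v w →
    x * (z * i) + (x′ * (z * j) + (x * (z * 0) + v)) + (y * (z * i) + (y′ * (z * j) + (y * (z * 0) + w)))
      ≡ (x + y) * (z * i) + (x′ + y′) * (z * j) + (v + w)
  lemma₁ = solve-∀
  lemma₂ : ∀ i j z t → 1 * (z * i) + 1 * (z * j) + (j + i) * t ≡ (i + j) * (z * 1 + t)
  lemma₂ = solve-∀

-- The new coordinates after weaving: every detour exchanges the two corners, so only the parity of
-- the number of marks matters.
alternate : A → A → List (Bool × B) → A
alternate x y []                = x
alternate x y ((false , _) ∷ T) = alternate x y T
alternate x y ((true  , _) ∷ T) = alternate y x T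

alternate-even : ∀ (x y : A) (T : List (Bool × B)) k → marks T ≡ 2 * k → alternate x y T ≡ x
alternate-odd  : ∀ (x y : A) (T : List (Bool × B)) k → suc (marks T) ≡ 2 * k → alternate x y T ≡ y
alternate-even x y [] k h = refl
alternate-even x y ((false , _) ∷ T) k h = alternate-even x y T k h
alternate-even x y ((true  , _) ∷ T) k h = alternate-odd y x T k h
alternate-odd x y [] (suc zero) ()
alternate-odd x y [] (suc (suc k)) ()
alternate-odd x y ((false , _) ∷ T) k h = alternate-odd x y T k h
alternate-odd x y ((true  , _) ∷ T) (suc k) h =
  alternate-even y x T k (suc-injective (trans (suc-injective h) (+-suc k (k + 0))))

tally-always-inner : ∀ b (i : Fin N) (k κ : Vertex N) (u s : Vertex n) R →
  tally always (k Vec.++ u) (κ Vec.++ s) (map joinStep ((b , inj₁ i) ∷ R))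
    ≡ δ k κ * δ u s + tally always (k Vec.++ u) (flip i κ Vec.++ s) (map joinStep R)
tally-always-inner b i k κ u s R =
  cong₂ _+_ (trans (*-identityʳ _) (δ-++ k κ u s))
            (cong (λ v → tally always (k Vec.++ u) v (map joinStep R)) (flip-↑ˡ i κ s))

tally-always-outer : ∀ b (d : Fin n) (k κ : Vertex N) (u s : Vertex n) R →
  tally always (k Vec.++ u) (κ Vec.++ s) (map joinStep ((b , inj₂ d) ∷ R))
    ≡ δ k κ * δ u s + tally always (k Vec.++ u) (κ Vec.++ flip d s) (map joinStep R)
tally-always-outer b d k κ u s R =
  cong₂ _+_ (trans (*-identityʳ _) (δ-++ k κ u s))
            (cong (λ v → tally always (k Vec.++ u) v (map joinStep R)) (flip-↑ʳ d κ s))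

-- The detours only move along the path `κ`, `μ`, `κ′`, back and forth, so a visit of `T` yields at
-- most one visit at each of these three values. Charging all three even at unmarked vertices gives
-- a product, at the price of an inequality.
tally-weave : ∀ {i j : Fin N} {κ μ κ′} → flip i κ ≡ μ → flip j μ ≡ κ′ → flip j κ′ ≡ μ → flip i μ ≡ κ →
  ∀ k (u s : Vertex n) T R →
  tally always (k Vec.++ u) (κ Vec.++ s) (map joinStep (weave i j T ++ R))
    ≤ (δ k κ + δ k μ + δ k κ′) * tally always u s T
      + tally always (k Vec.++ u) (alternate κ κ′ T Vec.++ end s T) (map joinStep R)
tally-weave {κ = κ} {μ} {κ′} p q r t k u s [] R =
  ≤-reflexive (cong (_+ tally always (k Vec.++ u) (κ Vec.++ s) (map joinStep R)) (sym (*-zeroʳ (δ k κ + δ k μ + δ k κ′))))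
tally-weave {i = i} {j} {κ} {μ} {κ′} p q r t k u s ((false , d) ∷ T) R = begin
  tally always (k Vec.++ u) (κ Vec.++ s) (map joinStep ((false , inj₂ d) ∷ weave i j T ++ R))
    ≡⟨ tally-always-outer false d k κ u s (weave i j T ++ R) ⟩
  δ k κ * δ u s + tally always (k Vec.++ u) (κ Vec.++ flip d s) (map joinStep (weave i j T ++ R))
    ≤⟨ +-monoʳ-≤ (δ k κ * δ u s) (tally-weave p q r t k u (flip d s) T R) ⟩
  δ k κ * δ u s + ((δ k κ + δ k μ + δ k κ′) * tally always u (flip d s) T + remaining)
    ≤⟨ m≤m+n _ ((δ k μ + δ k κ′) * δ u s) ⟩
  δ k κ * δ u s + ((δ k κ + δ k μ + δ k κ′) * tally always u (flip d s) T + remaining) + (δ k μ + δ k κ′) * δ u s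
    ≡⟨ lemma (δ k κ) (δ k μ) (δ k κ′) (δ u s) _ remaining ⟩
  (δ k κ + δ k μ + δ k κ′) * (δ u s * 1 + tally always u (flip d s) T) + remaining ∎
  where
  remaining : ℕ
  remaining = tally always (k Vec.++ u) (alternate κ κ′ T Vec.++ end (flip d s) T) (map joinStep R)
  lemma : ∀ x y z w t r → x * w + ((x + y + z) * t + r) + (y + z) * w ≡ (x + y + z) * (w * 1 + t) + r
  lemma = solve-∀
-- After the detour the path is run backwards with `i` and `j` exchanged; the hypotheses for the way
-- back become those for the way out.
tally-weave {i = i} {j} {κ} {μ} {κ′} refl refl r t k u s ((true , d) ∷ T) R = begin
  tally always (k Vec.++ u) (κ Vec.++ s) (map joinStep ((true , inj₁ i) ∷ (false , inj₁ j) ∷ (false , inj₂ d) ∷ weave j i T ++ R))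
    ≡⟨ tally-always-inner true i k κ u s ((false , inj₁ j) ∷ (false , inj₂ d) ∷ weave j i T ++ R) ⟩
  δ k κ * δ u s + tally always (k Vec.++ u) (μ Vec.++ s) (map joinStep ((false , inj₁ j) ∷ (false , inj₂ d) ∷ weave j i T ++ R))
    ≡⟨ cong (δ k κ * δ u s +_) (tally-always-inner false j k μ u s ((false , inj₂ d) ∷ weave j i T ++ R)) ⟩
  δ k κ * δ u s + (δ k μ * δ u s + tally always (k Vec.++ u) (κ′ Vec.++ s) (map joinStep ((false , inj₂ d) ∷ weave j i T ++ R)))
    ≡⟨ cong (λ x → δ k κ * δ u s + (δ k μ * δ u s + x)) (tally-always-outer false d k κ′ u s (weave j i T ++ R)) ⟩
  δ k κ * δ u s + (δ k μ * δ u s + (δ k κ′ * δ u s + tally always (k Vec.++ u) (κ′ Vec.++ flip d s) (map joinStep (weave j i T ++ R))))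
    ≤⟨ +-monoʳ-≤ (δ k κ * δ u s) (+-monoʳ-≤ (δ k μ * δ u s) (+-monoʳ-≤ (δ k κ′ * δ u s)
         (tally-weave r t refl refl k u (flip d s) T R))) ⟩
  δ k κ * δ u s + (δ k μ * δ u s + (δ k κ′ * δ u s + ((δ k κ′ + δ k μ + δ k κ) * tally always u (flip d s) T + remaining)))
    ≡⟨ lemma (δ k κ) (δ k μ) (δ k κ′) (δ u s) _ remaining ⟩
  (δ k κ + δ k μ + δ k κ′) * (δ u s * 1 + tally always u (flip d s) T) + remaining ∎
  where
  remaining : ℕ
  remaining = tally always (k Vec.++ u) (alternate κ′ κ T Vec.++ end (flip d s) T) (map joinStep R)
  lemma : ∀ x y z w t r → x * w + (y * w + (z * w + ((z + y + x) * t + r))) ≡ (x + y + z) * (w * 1 + t) + r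
  lemma = solve-∀

end-inner : ∀ b (i : Fin N) (κ : Vertex N) (s : Vertex n) R →
  end (κ Vec.++ s) (map joinStep ((b , inj₁ i) ∷ R)) ≡ end (flip i κ Vec.++ s) (map joinStep R)
end-inner b i κ s R = cong (λ v → end v (map joinStep R)) (flip-↑ˡ i κ s)

end-outer : ∀ b (d : Fin n) (κ : Vertex N) (s : Vertex n) R →
  end (κ Vec.++ s) (map joinStep ((b , inj₂ d) ∷ R)) ≡ end (κ Vec.++ flip d s) (map joinStep R)
end-outer b d κ s R = cong (λ v → end v (map joinStep R)) (flip-↑ʳ d κ s)

end-weave : ∀ {i j : Fin N} {κ κ′} → flip j (flip i κ) ≡ κ′ → flip i (flip j κ′) ≡ κ →
  ∀ (s : Vertex n) T R → end (κ Vec.++ s) (map joinStep (weave i j T ++ R))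
                       ≡ end (alternate κ κ′ T Vec.++ end s T) (map joinStep R)
end-weave p q s [] R = refl
end-weave {i = i} {j} {κ} p q s ((false , d) ∷ T) R =
  trans (end-outer false d κ s (weave i j T ++ R)) (end-weave p q (flip d s) T R)
end-weave {i = i} {j} {κ} {κ′} refl q s ((true , d) ∷ T) R =
  trans (end-inner true i κ s ((false , inj₁ j) ∷ (false , inj₂ d) ∷ weave j i T ++ R))
    (trans (end-inner false j (flip i κ) s ((false , inj₂ d) ∷ weave j i T ++ R))
      (trans (end-outer false d κ′ s (weave j i T ++ R)) (end-weave q refl (flip d s) T R)))

-- A vertex is a subset of the coordinates, so the search over subsets applies: no counterexample is
-- found.
allVertices? : {P : Vertex n → Set} → (∀ u → Dec (P u)) → Dec (∀ u → P u)
allVertices? P? = map′ (λ none u → decidable-stable (P? u) (λ ¬p → none (u , ¬p)))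
                       (λ all (u , ¬p) → ¬p (all u))
                       (¬? (anySubset? (λ u → ¬? (P? u))))

-- The extension by four coordinates.

module Extend {m n} (tour : Tour m n) where
  open Tour tour

  block : Fin 4 → Fin 4 → List (SplitStep 4 n)
  block i j = (true , inj₂ first) ∷ weave i j rest

  -- A block makes no detour at `first`; the four directions owed there are the crossing and the
  -- three return steps. Started at 0000, the first block ends at 1100, and crossing by `0F` reaches
  -- 0100, the corner of the square that the alternating detours avoid.
  ascent descent detoured : List (SplitStep 4 n)
  descent  = (false , inj₁ 2F) ∷ (false , inj₁ 1F) ∷ (false , inj₁ 3F) ∷ []
  ascent   = (false , inj₁ 0F) ∷ block 2F 3F ++ descent
  detoured = block 0F 1F ++ ascent

  layer-block-++ : ∀ (g : SplitStep 4 n → ℕ) p u b s i j R →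
    layer g p u b s (block i j ++ R) ≡ layer g p u b s (block i j) + layer g p u b s R
  layer-block-++ g p u b s i j R =
    trans (cong (_ +_) (layer-weave-++ g p u b (flip first s) i j rest R))
      (trans (sym (+-assoc (eq p b * (δ u s * g (true , inj₂ first))) _ _))
             (cong (λ v → layer g p u b s (block i j) + layer g p u b v R) (closed s)))

  layer-detoured : ∀ (g : SplitStep 4 n → ℕ) p u s → layer g p u false s detoured ≡
    layer g p u false s (block 0F 1F) + (eq p false * (δ u s * g (false , inj₁ 0F)) +
      (layer g p u true s (block 2F 3F) + (eq p true * (δ u s * g (false , inj₁ 2F)) +
        (eq p false * (δ u s * g (false , inj₁ 1F)) + (eq p true * (δ u s * g (false , inj₁ 3F)) + 0)))))
  layer-detoured g p u s =
    trans (layer-block-++ g p u false s 0F 1F ascent)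
          (cong (λ x → layer g p u false s (block 0F 1F) + (eq p false * (δ u s * g (false , inj₁ 0F)) + x))
                (layer-block-++ g p u true s 2F 3F descent))

  -- One pass runs in each layer, so either layer sees `walk` exactly once; the connecting steps
  -- weigh nothing.
  layer-detoured-carried : ∀ (g′ : SplitStep 4 n → ℕ) (g : Step n → ℕ) →
    (∀ i → g′ (false , inj₁ i) ≡ 0) →
    (∀ b d → g′ (b , inj₂ d) ≡ g (b , d)) →
    (∀ i d → g′ (true , inj₁ i) + g′ (false , inj₂ d) ≡ g (true , d)) →
    ∀ p u s → layer g′ p u false s detoured ≡ tally g u s walk
  layer-detoured-carried g′ g h₀ h₁ h₂ p u s
    rewrite layer-detoured g′ p u s | h₀ 0F | h₀ 1F | h₀ 2F | h₀ 3F
          | layer-weave-carried g′ g h₀ (h₁ false) h₂ p u false (flip first s) 0F 1F rest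
          | layer-weave-carried g′ g h₀ (h₁ false) h₂ p u true (flip first s) 2F 3F rest
          | h₁ true first =
    trans (lemma (eq p false) (eq p true) (δ u s) (g (true , first)) _)
          (trans (cong (_* tally g u s walk) (eq-total p)) (*-identityˡ _))
    where
    lemma : ∀ x y z v t →
      (x * (z * v) + x * t) + (x * (z * 0) + ((y * (z * v) + y * t) + (y * (z * 0) + (x * (z * 0) + (y * (z * 0) + 0)))))
        ≡ (x + y) * (z * v + t)
    lemma = solve-∀

  layer-block-switch : ∀ f u b s i j →
    layer (dirIs (f ↑ˡ n) ∘ joinStep) false u b s (block i j) + layer (dirIs (f ↑ˡ n) ∘ joinStep) true u b s (block i j)
      ≡ (δF f i + δF f j) * tally isMarked u (flip first s) rest
  layer-block-switch f u b s i j rewrite δF-inner-outer f first =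
    trans (lemma (eq false b) (eq true b) (δ u s) _ _) (layer-weave-switch f u b (flip first s) i j rest)
    where
    lemma : ∀ x y z v w → x * (z * 0) + v + (y * (z * 0) + w) ≡ v + w
    lemma = solve-∀

  -- Direction `f` occurs in the detours of exactly one block, hence once at every marked vertex of
  -- `rest`, and once among the connecting steps, which stand over the marked vertex `s`. Together
  -- these are all marks of `walk`.
  layer-detoured-switch : ∀ f u s →
    layer (dirIs (f ↑ˡ n) ∘ joinStep) false u false s detoured + layer (dirIs (f ↑ˡ n) ∘ joinStep) true u false s detoured
      ≡ tally isMarked u s walk
  layer-detoured-switch f u s = begin-equality
    on false detoured + on true detoured
      ≡⟨ cong₂ _+_ (layer-detoured g false u s) (layer-detoured g true u s) ⟩
    _
      ≡⟨ lemma (δ u s) (g (false , inj₁ 0F)) (g (false , inj₁ 1F)) (g (false , inj₁ 2F)) (g (false , inj₁ 3F))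
               (layer g false u false s (block 0F 1F)) (layer g false u true s (block 2F 3F))
               (layer g true u false s (block 0F 1F)) (layer g true u true s (block 2F 3F)) ⟩
    (layer g false u false s (block 0F 1F) + layer g true u false s (block 0F 1F))
      + (layer g false u true s (block 2F 3F) + layer g true u true s (block 2F 3F))
      + δ u s * (g (false , inj₁ 0F) + g (false , inj₁ 1F) + g (false , inj₁ 2F) + g (false , inj₁ 3F))
      ≡⟨ cong (_+ δ u s * (g (false , inj₁ 0F) + g (false , inj₁ 1F) + g (false , inj₁ 2F) + g (false , inj₁ 3F)))
              (cong₂ _+_ (layer-block-switch f u false s 0F 1F) (layer-block-switch f u true s 2F 3F)) ⟩
    (δF f 0F + δF f 1F) * M + (δF f 2F + δF f 3F) * M
      + δ u s * (g (false , inj₁ 0F) + g (false , inj₁ 1F) + g (false , inj₁ 2F) + g (false , inj₁ 3F))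
      ≡⟨ collect f ⟩
    tally isMarked u s walk ∎
    where
    g = dirIs (f ↑ˡ n) ∘ joinStep
    on : Bool → List (SplitStep 4 n) → ℕ
    on p = layer g p u false s
    M = tally isMarked u (flip first s) rest
    lemma : ∀ x a b c d A B C D →
      A + (1 * (x * a) + (B + (0 * (x * c) + (1 * (x * b) + (0 * (x * d) + 0)))))
        + (C + (0 * (x * a) + (D + (1 * (x * c) + (0 * (x * b) + (1 * (x * d) + 0))))))
        ≡ A + C + (B + D) + x * (a + b + c + d)
    lemma = solve-∀
    early : ∀ x M → 1 * M + 0 * M + x * 1 ≡ x * 1 + M
    early = solve-∀
    late : ∀ x M → 0 * M + 1 * M + x * 1 ≡ x * 1 + M
    late = solve-∀
    collect : ∀ f → (δF f 0F + δF f 1F) * M + (δF f 2F + δF f 3F) * M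
      + δ u s * (δF (f ↑ˡ n) (0F ↑ˡ n) + δF (f ↑ˡ n) (1F ↑ˡ n) + δF (f ↑ˡ n) (2F ↑ˡ n) + δF (f ↑ˡ n) (3F ↑ˡ n))
      ≡ δ u s * 1 + M
    collect 0F = early (δ u s) M
    collect 1F = early (δ u s) M
    collect 2F = late (δ u s) M
    collect 3F = late (δ u s) M

  length-detoured : length detoured ≡ 2 ^ suc m * (4 + n)
  length-detoured = begin-equality
    length detoured
      ≡⟨ length-++ (block 0F 1F) {ascent} ⟩
    length (block 0F 1F) + suc (length (block 2F 3F ++ descent))
      ≡⟨ cong (λ x → length (block 0F 1F) + suc x) (length-++ (block 2F 3F) {descent}) ⟩
    length (block 0F 1F) + suc (length (block 2F 3F) + 3)
      ≡⟨ cong₂ (λ x y → suc x + suc (suc y + 3)) (length-weave 0F 1F rest) (length-weave 2F 3F rest) ⟩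
    suc (length rest + 2 * marks rest) + suc (suc (length rest + 2 * marks rest) + 3)
      -- The four connecting steps make up for the two-step detour that each block lacks at `first`.
      ≡⟨ lemma₁ (length rest) (marks rest) ⟩
    2 * length walk + 4 * marks walk
      ≡⟨ cong₂ (λ x y → 2 * x + 4 * y) length-walk marks-walk ⟩
    2 * (2 ^ m * n) + 4 * (2 * 2 ^ m)
      ≡⟨ lemma₂ (2 ^ m) n ⟩
    2 ^ suc m * (4 + n) ∎
    where
    lemma₁ : ∀ l k → 1 + (l + 2 * k) + (1 + (1 + (l + 2 * k) + 3)) ≡ 2 * (1 + l) + 4 * (1 + k)
    lemma₁ = solve-∀
    lemma₂ : ∀ p n → 2 * (p * n) + 4 * (2 * p) ≡ 2 * p * (4 + n)
    lemma₂ = solve-∀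

  marks-detoured : marks detoured ≡ 2 ^ suc (suc m)
  marks-detoured = begin-equality
    marks detoured
      ≡⟨ total-++ isMarked (block 0F 1F) ascent ⟩
    marks (block 0F 1F) + marks (block 2F 3F ++ descent)
      ≡⟨ cong (marks (block 0F 1F) +_) (total-++ isMarked (block 2F 3F) _) ⟩
    marks (block 0F 1F) + (marks (block 2F 3F) + 0)
      ≡⟨ cong₂ (λ x y → suc x + (suc y + 0)) (marks-weave 0F 1F rest) (marks-weave 2F 3F rest) ⟩
    2 * marks walk
      ≡⟨ cong (2 *_) marks-walk ⟩
    2 ^ suc (suc m) ∎

  -- `first` takes one of the 2^(m + 1) marks, so `rest` has an odd number of them.
  alternate-rest : ∀ {A : Set} (x y : A) → alternate x y rest ≡ y
  alternate-rest x y = alternate-odd x y rest (2 ^ m) marks-walk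

  end-block : ∀ {i j κ κ′} → flip j (flip i κ) ≡ κ′ → flip i (flip j κ′) ≡ κ →
    ∀ s R → end (κ Vec.++ s) (map joinStep (block i j ++ R)) ≡ end (κ′ Vec.++ s) (map joinStep R)
  end-block {i} {j} {κ} {κ′} p q s R =
    trans (end-outer true first κ s (weave i j rest ++ R))
      (trans (end-weave p q (flip first s) rest R)
             (cong₂ (λ x y → end (x Vec.++ y) (map joinStep R)) (alternate-rest κ κ′) (closed s)))

  closed-detoured : ∀ (κ : Vertex 4) s → end (κ Vec.++ s) (map joinStep detoured) ≡ κ Vec.++ s
  closed-detoured (w ∷ x ∷ y ∷ z ∷ []) s =
    trans (end-block refl (cong₂ (λ w x → w ∷ x ∷ y ∷ z ∷ []) (not-involutive w) (not-involutive x)) s _)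
      (trans (end-block refl (cong₂ (λ y z → not (not w) ∷ not x ∷ y ∷ z ∷ []) (not-involutive y) (not-involutive z)) s _)
        (cong₂ (λ p q → p Vec.++ q Vec.++ s)
          (cong₂ (λ w x → w ∷ x ∷ []) (not-involutive w) (not-involutive x))
          (cong₂ (λ y z → y ∷ z ∷ []) (not-involutive y) (not-involutive z))))

  -- The start of `walk` and its later vertices are separate: over the start the new coordinates
  -- take the corner values, over a later vertex at most the three values of each block. Each list
  -- only has to be free of repetitions by itself, since `X` and `M` cannot both be positive.
  simple-detoured : ∀ (k : Vertex 4) u →
    tally always (k Vec.++ u) (Vec.replicate 4 false Vec.++ Vec.replicate n false) (map joinStep detoured) ≤ 1
  simple-detoured k u = begin
    visits k₀ o detoured
      ≡⟨ tally-always-outer true first k k₀ u o (weave 0F 1F rest ++ ascent) ⟩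
    δ k k₀ * X + visits k₀ (flip first o) (weave 0F 1F rest ++ ascent)
      ≤⟨ +-monoʳ-≤ (δ k k₀ * X) (tally-weave refl refl refl refl k u (flip first o) rest ascent) ⟩
    δ k k₀ * X + (B₁ * M + visits (alternate k₀ k₂ rest) (end o walk) ascent)
      ≡⟨ cong₂ (λ κ s → δ k k₀ * X + (B₁ * M + visits κ s ascent)) (alternate-rest k₀ k₂) (closed o) ⟩
    δ k k₀ * X + (B₁ * M + visits k₂ o ascent)
      ≡⟨ cong (λ x → δ k k₀ * X + (B₁ * M + x))
           (trans (tally-always-inner false 0F k k₂ u o (block 2F 3F ++ descent))
                  (cong (δ k k₂ * X +_) (tally-always-outer true first k k₃ u o (weave 2F 3F rest ++ descent)))) ⟩
    δ k k₀ * X + (B₁ * M + (δ k k₂ * X + (δ k k₃ * X + visits k₃ (flip first o) (weave 2F 3F rest ++ descent))))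
      ≤⟨ +-monoʳ-≤ (δ k k₀ * X) (+-monoʳ-≤ (B₁ * M) (+-monoʳ-≤ (δ k k₂ * X) (+-monoʳ-≤ (δ k k₃ * X)
           (tally-weave refl refl refl refl k u (flip first o) rest descent)))) ⟩
    δ k k₀ * X + (B₁ * M + (δ k k₂ * X + (δ k k₃ * X + (B₂ * M + visits (alternate k₃ k₅ rest) (end o walk) descent))))
      ≡⟨ cong (λ x → δ k k₀ * X + (B₁ * M + (δ k k₂ * X + (δ k k₃ * X + (B₂ * M + x)))))
           (trans (cong₂ (λ κ s → visits κ s descent) (alternate-rest k₃ k₅) (closed o)) last) ⟩
    δ k k₀ * X + (B₁ * M + (δ k k₂ * X + (δ k k₃ * X + (B₂ * M
      + (δ k k₅ * X + (δ k k₆ * X + (δ k k₇ * X + 0)))))))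
      ≡⟨ lemma (δ k k₀) B₁ (δ k k₂) (δ k k₃) B₂ (δ k k₅) (δ k k₆) (δ k k₇) X M ⟩
    total (δ k) (k₀ ∷ k₂ ∷ k₃ ∷ k₅ ∷ k₆ ∷ k₇ ∷ []) * X + (B₁ + B₂) * M
      ≤⟨ +-mono-≤ (*-monoˡ-≤ X (distinct-corners k)) (*-monoˡ-≤ M (distinct-layers k)) ⟩
    1 * X + 1 * M
      ≡⟨ lemma′ X M ⟩
    X * 1 + M
      ≤⟨ simple u ⟩
    1 ∎
    where
    o = Vec.replicate n false
    X = δ u o
    M = tally always u (flip first o) rest
    visits : Vertex 4 → Vertex n → List (SplitStep 4 n) → ℕ
    visits κ s R = tally always (k Vec.++ u) (κ Vec.++ s) (map joinStep R)
    -- An 8-cycle of Q_4 in this order: `k₁` and `k₄` are the middles of the detours, `k₂` to `k₃`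
    -- is the crossing, and `k₅` back to `k₀` is the return.
    k₀ k₁ k₂ k₃ k₄ k₅ k₆ k₇ : Vertex 4
    k₀ = false ∷ false ∷ false ∷ false ∷ []
    k₁ = true  ∷ false ∷ false ∷ false ∷ []
    k₂ = true  ∷ true  ∷ false ∷ false ∷ []
    k₃ = false ∷ true  ∷ false ∷ false ∷ []
    k₄ = false ∷ true  ∷ true  ∷ false ∷ []
    k₅ = false ∷ true  ∷ true  ∷ true  ∷ []
    k₆ = false ∷ true  ∷ false ∷ true  ∷ []
    k₇ = false ∷ false ∷ false ∷ true  ∷ []
    B₁ = δ k k₀ + δ k k₁ + δ k k₂
    B₂ = δ k k₃ + δ k k₄ + δ k k₅
    last : visits k₅ o descent ≡ δ k k₅ * X + (δ k k₆ * X + (δ k k₇ * X + 0))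
    last = trans (tally-always-inner false 2F k k₅ u o ((false , inj₁ 1F) ∷ (false , inj₁ 3F) ∷ []))
      (cong (δ k k₅ * X +_) (trans (tally-always-inner false 1F k k₆ u o ((false , inj₁ 3F) ∷ []))
        (cong (δ k k₆ * X +_) (tally-always-inner false 3F k k₇ u o []))))
    distinct-corners : ∀ k → total (δ k) (k₀ ∷ k₂ ∷ k₃ ∷ k₅ ∷ k₆ ∷ k₇ ∷ []) ≤ 1
    distinct-corners = from-yes (allVertices? λ k → total (δ k) (k₀ ∷ k₂ ∷ k₃ ∷ k₅ ∷ k₆ ∷ k₇ ∷ []) ≤? 1)
    distinct-layers : ∀ k → δ k k₀ + δ k k₁ + δ k k₂ + (δ k k₃ + δ k k₄ + δ k k₅) ≤ 1
    distinct-layers = from-yes (allVertices? λ k → δ k k₀ + δ k k₁ + δ k k₂ + (δ k k₃ + δ k k₄ + δ k k₅) ≤? 1)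
    lemma : ∀ a p b c q d e f x m →
      a * x + (p * m + (b * x + (c * x + (q * m + (d * x + (e * x + (f * x + 0)))))))
        ≡ (a + (b + (c + (d + (e + (f + 0)))))) * x + (p + q) * m
    lemma = solve-∀
    lemma′ : ∀ x m → 1 * x + 1 * m ≡ x * 1 + m
    lemma′ = solve-∀

  extend : Tour (suc m) (4 + n)
  extend = tourFromLayers {N = 4} starts first (weave 0F 1F rest ++ ascent) length-detoured marks-detoured inner outer marked
                          closed-detoured simple-detoured
    where
    inner : ∀ u i → total (λ s → layer (dirIs (i ↑ˡ n) ∘ joinStep) false u false s detoured) starts
                  + total (λ s → layer (dirIs (i ↑ˡ n) ∘ joinStep) true u false s detoured) starts ≡ 1
    inner u i = trans (sym (total-+ _ (λ s → layer (dirIs (i ↑ˡ n) ∘ joinStep) true u false s detoured) starts))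
                      (trans (total-cong (layer-detoured-switch i u) starts) (marked-once u))
    used : ∀ e p u s → layer (dirIs (4 ↑ʳ e) ∘ joinStep) p u false s detoured ≡ tally (dirIs e) u s walk
    used e = layer-detoured-carried (dirIs (4 ↑ʳ e) ∘ joinStep) (dirIs e)
      (δF-outer-inner e) (λ _ _ → refl) (λ i d → cong (_+ δF e d) (δF-outer-inner e i))
    outer : ∀ p u e → total (λ s → layer (dirIs (4 ↑ʳ e) ∘ joinStep) p u false s detoured) starts
                    + total (λ s → layer (dirIs (4 ↑ʳ e) ∘ joinStep) p (flip e u) false s detoured) starts ≡ 1
    outer p u e = trans (cong₂ _+_ (total-cong (used e p u) starts) (total-cong (used e p (flip e u)) starts))
                        (edges-once u e)
    marked : ∀ p u → total (λ s → layer (isMarked ∘ joinStep) p u false s detoured) starts ≡ 1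
    marked p u = trans (total-cong (layer-detoured-carried (isMarked ∘ joinStep) isMarked
                          (λ _ → refl) first-mark (λ _ _ → refl) p u) starts) (marked-once u)
      where
      first-mark : ∀ b d → isMarked {A = Fin (4 + n)} (joinStep (b , inj₂ d)) ≡ isMarked (b , d)
      first-mark false d = refl
      first-mark true  d = refl

open Extend using (extend)

-- Tours with m = 1, from two laps through all coordinates.

inner : List (Bool × Fin N) → List (SplitStep N n)
inner = map (map₂ inj₁)

toggle : Bool → List A → Bool
toggle b []      = b
toggle b (_ ∷ J) = toggle (not b) J

toggle-even : ∀ b (J : List A) k → length J ≡ k * 2 → toggle b J ≡ b
toggle-even b []          k       h = refl
toggle-even b (_ ∷ [])    zero    ()
toggle-even b (_ ∷ [])    (suc k) ()
toggle-even b (_ ∷ _ ∷ J) (suc k) h rewrite not-involutive b =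
  toggle-even b J k (suc-injective (suc-injective h))

layer-inner-++ : ∀ (g : SplitStep N n → ℕ) p u b s J R →
  layer g p u b s (inner J ++ R) ≡ layer g p u b s (inner J) + layer g p u (toggle b J) s R
layer-inner-++ g p u b s []      R = refl
layer-inner-++ g p u b s (t ∷ J) R =
  trans (cong (_ +_) (layer-inner-++ g p u (not b) s J R)) (sym (+-assoc (eq p b * _) _ _))

layer-inner-outer : ∀ (e : Fin n) p u b s (J : List (Bool × Fin N)) →
  layer (dirIs (N ↑ʳ e) ∘ joinStep) p u b s (inner J) ≡ 0
layer-inner-outer e p u b s []            = refl
layer-inner-outer e p u b s ((_ , i) ∷ J)
  rewrite δF-outer-inner e i | *-zeroʳ (δ u s) | *-zeroʳ (eq p b) = layer-inner-outer e p u (not b) s J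

layer-inner-unmarked : ∀ p (u : Vertex n) b s (J : List (Bool × Fin N)) → marks J ≡ 0 →
  layer (isMarked ∘ joinStep) p u b s (inner J) ≡ 0
layer-inner-unmarked p u b s []                h = refl
layer-inner-unmarked p u b s ((false , _) ∷ J) h
  rewrite *-zeroʳ (δ u s) | *-zeroʳ (eq p b) = layer-inner-unmarked p u (not b) s J h

layer-inner-switch : ∀ (f : Fin N) (u : Vertex n) b s J →
  layer (dirIs (f ↑ˡ n) ∘ joinStep) false u b s (inner J) + layer (dirIs (f ↑ˡ n) ∘ joinStep) true u b s (inner J)
    ≡ δ u s * total (dirIs f) J
layer-inner-switch f u b s [] = sym (*-zeroʳ (δ u s))
layer-inner-switch {n = n} f u b s ((_ , i) ∷ J) rewrite δF-inner {n = n} f i =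
  trans (lemma (eq false b) (eq true b) (δ u s * δF f i) _ _)
    (trans (cong₂ (λ x y → x * (δ u s * δF f i) + y) (eq-exclusive b) (layer-inner-switch f u (not b) s J))
           (lemma′ (δ u s) (δF f i) _))
  where
  lemma : ∀ x y z v w → x * z + v + (y * z + w) ≡ (x + y) * z + (v + w)
  lemma = solve-∀
  lemma′ : ∀ x y z → 1 * (x * y) + x * z ≡ x * (y + z)
  lemma′ = solve-∀

tally-inner : ∀ (k κ : Vertex N) (u s : Vertex n) J R →
  tally always (k Vec.++ u) (κ Vec.++ s) (map joinStep (inner J ++ R))
    ≡ δ u s * tally always k κ J + tally always (k Vec.++ u) (end κ J Vec.++ s) (map joinStep R)
tally-inner k κ u s [] R = cong (_+ tally always (k Vec.++ u) (κ Vec.++ s) (map joinStep R)) (sym (*-zeroʳ (δ u s)))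
tally-inner k κ u s ((b , i) ∷ J) R =
  trans (tally-always-inner b i k κ u s (inner J ++ R))
    (trans (cong (δ k κ * δ u s +_) (tally-inner k (flip i κ) u s J R)) (lemma (δ k κ) (δ u s) _ _))
  where
  lemma : ∀ x y z w → x * y + (y * z + w) ≡ y * (x * 1 + z) + w
  lemma = solve-∀

end-inner-walk : ∀ (κ : Vertex N) (s : Vertex n) J R →
  end (κ Vec.++ s) (map joinStep (inner J ++ R)) ≡ end (end κ J Vec.++ s) (map joinStep R)
end-inner-walk κ s []            R = refl
end-inner-walk κ s ((b , i) ∷ J) R =
  trans (end-inner b i κ s (inner J ++ R)) (end-inner-walk (flip i κ) s J R)

raise : Step N → Step (suc N)
raise = map₂ suc

-- Only the first step can carry a mark: a lap of the base walk has two marks, one here and one at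
-- the outer flip just before.
sweep : Bool → ∀ N → List (Step N)
sweep b zero    = []
sweep b (suc N) = (b , zero) ∷ map raise (sweep false N)

length-sweep : ∀ b N → length (sweep b N) ≡ N
length-sweep b zero    = refl
length-sweep b (suc N) = cong suc (trans (length-map raise (sweep false N)) (length-sweep false N))

marks-suc : (J : List (Step N)) → marks (map raise J) ≡ marks J
marks-suc []                = refl
marks-suc ((false , _) ∷ J) = marks-suc J
marks-suc ((true  , _) ∷ J) = cong suc (marks-suc J)

unmarked-sweep : ∀ N → marks (map raise (sweep false N)) ≡ 0
unmarked-sweep zero    = refl
unmarked-sweep (suc N) = trans (marks-suc (sweep false (suc N))) (unmarked-sweep N)

sweep-once : ∀ b (f : Fin N) → total (dirIs f) (sweep b N) ≡ 1
sweep-once {suc N} b zero    =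
  cong suc (trans (total-map (dirIs zero) raise (sweep false N)) (total-0 (sweep false N)))
sweep-once {suc N} b (suc f) =
  trans (total-map (dirIs (suc f)) raise (sweep false N)) (sweep-once false f)

tally-suc : ∀ x y (k κ : Vertex N) J →
  tally always (x ∷ k) (y ∷ κ) (map raise J) ≡ eq x y * tally always k κ J
tally-suc x y k κ []            = sym (*-zeroʳ (eq x y))
tally-suc x y k κ ((_ , i) ∷ J) =
  trans (cong (eq x y * δ k κ * 1 +_) (tally-suc x y k (flip i κ) J)) (lemma (eq x y) (δ k κ) _)
  where
  lemma : ∀ x y z → x * y * 1 + x * z ≡ x * (y * 1 + z)
  lemma = solve-∀

end-suc : ∀ y (κ : Vertex N) J → end (y ∷ κ) (map raise J) ≡ y ∷ end κ J
end-suc y κ []            = refl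
end-suc y κ ((_ , i) ∷ J) = end-suc y (flip i κ) J

δ≤1 : (u v : Vertex n) → δ u v ≤ 1
δ≤1 []          []          = ≤-refl
δ≤1 (false ∷ u) (false ∷ v) = ≤-trans (≤-reflexive (*-identityˡ (δ u v))) (δ≤1 u v)
δ≤1 (false ∷ u) (true  ∷ v) = z≤n
δ≤1 (true  ∷ u) (false ∷ v) = z≤n
δ≤1 (true  ∷ u) (true  ∷ v) = ≤-trans (≤-reflexive (*-identityˡ (δ u v))) (δ≤1 u v)

-- The head coordinate is flipped first and never again, which separates the start from everything
-- later. The endpoint is included because on each sheet of the double lap it is one more vertex of
-- the walk.
sweep-simple : ∀ b (k κ : Vertex N) → tally always k κ (sweep b N) + δ k (end κ (sweep b N)) ≤ 1
sweep-simple b []      []      = ≤-refl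
sweep-simple {suc N} b (x ∷ k) (y ∷ κ)
  rewrite tally-suc x (not y) k κ (sweep false N) | end-suc (not y) κ (sweep false N) = cases x y
  where
  here  = δ k κ
  later = tally always k κ (sweep false N)
  last  = δ k (end κ (sweep false N))
  same : 1 * here * 1 + 0 * later + 0 * last ≤ 1
  same = ≤-trans (≤-reflexive (lemma here later last)) (δ≤1 k κ)
    where
    lemma : ∀ x y z → 1 * x * 1 + 0 * y + 0 * z ≡ x
    lemma = solve-∀
  opposite : 0 * here * 1 + 1 * later + 1 * last ≤ 1
  opposite = ≤-trans (≤-reflexive (lemma here later last)) (sweep-simple false k κ)
    where
    lemma : ∀ x y z → 0 * x * 1 + 1 * y + 1 * z ≡ y + z
    lemma = solve-∀
  cases : ∀ x y → eq x y * here * 1 + eq x (not y) * later + eq x (not y) * last ≤ 1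
  cases false false = same
  cases false true  = opposite
  cases true  false = opposite
  cases true  true  = same

module Twice (k : ℕ) where

  M : ℕ
  M = suc (k * 2)

  J : List (Step M)
  J = sweep true M

  -- Odd vectors are reached because M is odd: the second lap covers the parity class
  -- that the first one misses.
  laps : List (SplitStep M 1)
  laps = (true , inj₂ 0F) ∷ inner J ++ (true , inj₂ 0F) ∷ inner J ++ []

  toggle-J : ∀ b → toggle b J ≡ not b
  toggle-J b = toggle-even (not b) (map raise (sweep false (k * 2))) k
    (trans (length-map raise (sweep false (k * 2))) (length-sweep false (k * 2)))

  layer-laps : ∀ (g : SplitStep M 1 → ℕ) p x → layer g p (x ∷ []) false (false ∷ []) laps ≡
    eq p false * (eq x false * 1 * g (true , inj₂ 0F)) + (layer g p (x ∷ []) false (true ∷ []) (inner J) +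
      (eq p true * (eq x true * 1 * g (true , inj₂ 0F)) + layer g p (x ∷ []) true (false ∷ []) (inner J)))
  layer-laps g p x = cong (eq p false * (eq x false * 1 * g (true , inj₂ 0F)) +_)
    (trans (layer-inner-++ g p (x ∷ []) false (true ∷ []) J ((true , inj₂ 0F) ∷ inner J ++ []))
      (cong (layer g p (x ∷ []) false (true ∷ []) (inner J) +_)
        (trans (cong (λ b → layer g p (x ∷ []) b (true ∷ []) ((true , inj₂ 0F) ∷ inner J ++ [])) (toggle-J false))
          (cong (eq p true * (eq x true * 1 * g (true , inj₂ 0F)) +_)
                (trans (layer-inner-++ g p (x ∷ []) true (false ∷ []) J []) (+-identityʳ _))))))

  -- One sweep runs over `x` = `true` and the other over `x` = `false`, and each uses every inner
  -- direction once.
  switched : ∀ (f : Fin M) x →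
    layer (dirIs (f ↑ˡ 1) ∘ joinStep {M}) false (x ∷ []) false (false ∷ []) laps
      + layer (dirIs (f ↑ˡ 1) ∘ joinStep {M}) true (x ∷ []) false (false ∷ []) laps ≡ 1
  switched f x rewrite layer-laps (dirIs (f ↑ˡ 1) ∘ joinStep {M}) false x | layer-laps (dirIs (f ↑ˡ 1) ∘ joinStep {M}) true x
                     | δF-inner-outer {n = 1} f 0F =
    trans (lemma (eq x false) (eq x true) (on false (inner J)) _ (on true (inner J)) _)
      (trans (cong₂ _+_ (layer-inner-switch f (x ∷ []) false (true ∷ []) J) (layer-inner-switch f (x ∷ []) true (false ∷ []) J))
        (trans (cong (λ c → eq x true * 1 * c + eq x false * 1 * c) (sweep-once true f)) (once x)))
    where
    on : Bool → List (SplitStep M 1) → ℕ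
    on p = layer (dirIs (f ↑ˡ 1) ∘ joinStep {M}) p (x ∷ []) false (true ∷ [])
    lemma : ∀ x y a b c d → 1 * (x * 1 * 0) + (a + (0 * (y * 1 * 0) + b)) + (0 * (x * 1 * 0) + (c + (1 * (y * 1 * 0) + d)))
                            ≡ a + c + (b + d)
    lemma = solve-∀
    once : ∀ x → eq x true * 1 * 1 + eq x false * 1 * 1 ≡ 1
    once false = refl
    once true  = refl

  -- The first outer flip departs in layer `false`, the second in layer `true`, so a given layer
  -- sees exactly one of them, counted at one of its two ends.
  outer-once : ∀ p x →
    layer (dirIs (M ↑ʳ 0F) ∘ joinStep {M}) p (x ∷ []) false (false ∷ []) laps
      + layer (dirIs (M ↑ʳ 0F) ∘ joinStep {M}) p (not x ∷ []) false (false ∷ []) laps ≡ 1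
  outer-once p x
    rewrite layer-laps (dirIs (M ↑ʳ 0F) ∘ joinStep {M}) p x | layer-laps (dirIs (M ↑ʳ 0F) ∘ joinStep {M}) p (not x)
          | layer-inner-outer {N = M} 0F p (x ∷ []) false (true ∷ []) J
          | layer-inner-outer {N = M} 0F p (x ∷ []) true (false ∷ []) J
          | layer-inner-outer {N = M} 0F p (not x ∷ []) false (true ∷ []) J
          | layer-inner-outer {N = M} 0F p (not x ∷ []) true (false ∷ []) J
          | δF-outer {1} M 0F 0F = once p x
    where
    once : ∀ p x → eq p false * (eq x false * 1 * 1) + (0 + (eq p true * (eq x true * 1 * 1) + 0))
           + (eq p false * (eq (not x) false * 1 * 1) + (0 + (eq p true * (eq (not x) true * 1 * 1) + 0))) ≡ 1
    once false false = refl
    once false true  = refl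
    once true  false = refl
    once true  true  = refl

  marked-sweep : ∀ p (u : Vertex 1) b s → layer (isMarked ∘ joinStep {M}) p u b s (inner J) ≡ eq p b * (δ u s * 1)
  marked-sweep p u b s =
    trans (cong (eq p b * (δ u s * 1) +_)
                (layer-inner-unmarked p u (not b) s (map raise (sweep false (k * 2))) (unmarked-sweep (k * 2))))
          (+-identityʳ _)

  -- The four marks occupy the four combinations of layer and outer coordinate.
  marked : ∀ p x → layer (isMarked ∘ joinStep {M}) p (x ∷ []) false (false ∷ []) laps ≡ 1
  marked p x
    rewrite layer-laps (isMarked ∘ joinStep {M}) p x
          | marked-sweep p (x ∷ []) false (true ∷ []) | marked-sweep p (x ∷ []) true (false ∷ []) = once p x
    where
    once : ∀ p x → eq p false * (eq x false * 1 * 1) + (eq p false * (eq x true * 1 * 1) +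
                   (eq p true * (eq x true * 1 * 1) + eq p true * (eq x false * 1 * 1))) ≡ 1
    once false false = refl
    once false true  = refl
    once true  false = refl
    once true  true  = refl

  length-inner : ∀ (R : List (SplitStep M 1)) → length (inner J ++ R) ≡ M + length R
  length-inner R = trans (length-++ (inner J))
    (cong (_+ length R) (trans (length-map (map₂ inj₁) J) (length-sweep true M)))

  length-laps : length laps ≡ 2 ^ 1 * (M + 1)
  length-laps = trans (cong suc (trans (length-inner ((true , inj₂ 0F) ∷ inner J ++ []))
                                       (cong (λ x → M + suc x) (length-inner []))))
                      (lemma M)
    where
    lemma : ∀ M → 1 + (M + (1 + (M + 0))) ≡ 2 * (M + 1)
    lemma = solve-∀

  marks-inner : ∀ (J : List (Bool × Fin M)) R → marks (inner {n = 1} J ++ R) ≡ marks J + marks R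
  marks-inner []                R = refl
  marks-inner ((false , _) ∷ J) R = marks-inner J R
  marks-inner ((true  , _) ∷ J) R = cong suc (marks-inner J R)

  marks-laps : marks laps ≡ 2 ^ 2
  marks-laps = trans (cong suc (trans (marks-inner J ((true , inj₂ 0F) ∷ inner J ++ []))
                                      (cong₂ (λ x y → x + suc y) marks-J (marks-inner J []))))
                     (cong (λ x → 3 + (x + 0)) marks-J)
    where
    marks-J : marks J ≡ 1
    marks-J = cong suc (unmarked-sweep (k * 2))

  closed-laps : ∀ (κ : Vertex M) (s : Vertex 1) → end (κ Vec.++ s) (map joinStep laps) ≡ κ Vec.++ s
  closed-laps κ (x ∷ []) =
    trans (end-outer true 0F κ (x ∷ []) (inner J ++ (true , inj₂ 0F) ∷ inner J ++ []))
      (trans (end-inner-walk κ (not x ∷ []) J ((true , inj₂ 0F) ∷ inner J ++ []))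
        (trans (end-outer true 0F (end κ J) (not x ∷ []) (inner J ++ []))
          (trans (end-inner-walk (end κ J) (not (not x) ∷ []) J [])
                 (cong₂ (λ κ x → κ Vec.++ (x ∷ [])) (end-involutive κ J) (not-involutive x)))))

  simple-laps : ∀ (κ : Vertex M) (u : Vertex 1) →
    tally always (κ Vec.++ u) (Vec.replicate M false Vec.++ Vec.replicate 1 false) (map joinStep laps) ≤ 1
  simple-laps κ (x ∷ []) = ≤-trans (≤-reflexive expand) (bound x)
    where
    o  = Vec.replicate M false
    o′ = end o J
    expand : tally always (κ Vec.++ x ∷ []) (o Vec.++ false ∷ []) (map joinStep laps) ≡
      δ κ o * (eq x false * 1) + (eq x true * 1 * tally always κ o J +
        (δ κ o′ * (eq x true * 1) + (eq x false * 1 * tally always κ o′ J + 0)))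
    expand =
      trans (tally-always-outer true 0F κ o (x ∷ []) (false ∷ []) (inner J ++ (true , inj₂ 0F) ∷ inner J ++ []))
        (cong (δ κ o * (eq x false * 1) +_)
          (trans (tally-inner κ o (x ∷ []) (true ∷ []) J ((true , inj₂ 0F) ∷ inner J ++ []))
            (cong (eq x true * 1 * tally always κ o J +_)
              (trans (tally-always-outer true 0F κ o′ (x ∷ []) (true ∷ []) (inner J ++ []))
                (cong (δ κ o′ * (eq x true * 1) +_) (tally-inner κ o′ (x ∷ []) (false ∷ []) J []))))))
    bound : ∀ x → δ κ o * (eq x false * 1) + (eq x true * 1 * tally always κ o J +
        (δ κ o′ * (eq x true * 1) + (eq x false * 1 * tally always κ o′ J + 0))) ≤ 1
    -- On the sheet `false` the second sweep leads from `o′` back to `o`, so the starting vertex is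
    -- the endpoint of that sweep.
    bound false = ≤-trans (≤-reflexive (trans
        (lemma (δ κ o) (tally always κ o J) (δ κ o′) (tally always κ o′ J))
        (cong (λ v → tally always κ o′ J + δ κ v) (sym (end-involutive o J))))) (sweep-simple true κ o′)
      where
      lemma : ∀ a b c d → a * 1 + (0 * b + (c * 0 + (1 * d + 0))) ≡ d + a
      lemma = solve-∀
    bound true = ≤-trans (≤-reflexive
        (lemma (δ κ o) (tally always κ o J) (δ κ o′) (tally always κ o′ J))) (sweep-simple true κ o)
      where
      lemma : ∀ a b c d → a * 0 + (1 * b + (c * 1 + (0 * d + 0))) ≡ b + c
      lemma = solve-∀

  tour : Tour 1 (2 + k * 2)
  tour = subst (Tour 1) (+-comm M 1)
    (tourFromLayers (s₀ ∷ []) 0F (inner J ++ (true , inj₂ 0F) ∷ inner J ++ []) length-laps marks-laps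
      (λ { (x ∷ []) i → trans (pair (use (i ↑ˡ 1) false (x ∷ [])) (use (i ↑ˡ 1) true (x ∷ []))) (switched i x) })
      (λ { p (x ∷ []) 0F → trans (pair (use (M ↑ʳ 0F) p (x ∷ [])) (use (M ↑ʳ 0F) p (not x ∷ []))) (outer-once p x) })
      (λ { p (x ∷ []) → trans (+-identityʳ _) (marked p x) })
      closed-laps simple-laps)
    where
    s₀ : Vertex 1
    s₀ = false ∷ []
    use : Fin (M + 1) → Bool → Vertex 1 → ℕ
    use e p u = layer (dirIs e ∘ joinStep {M}) p u false s₀ laps
    pair : ∀ a b → a + 0 + (b + 0) ≡ a + b
    pair a b = cong₂ _+_ (+-identityʳ a) (+-identityʳ b)

-- A Hamiltonian cycle and its translate by 1110. The eight marks pick one vertex from each pair of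
-- vertices differing by 1110. An extension cannot produce this tour: it would have to start in
-- dimension 0.
tour₂₄ : Tour 2 4
tour₂₄ = record
  { starts      = S
  ; first       = 0F
  ; rest        = R
  ; length-walk = refl
  ; marks-walk  = refl
  ; edges-once  = from-yes (allVertices? λ u → all? λ e →
      total (λ s → tally (dirIs e) u s W) S + total (λ s → tally (dirIs e) (flip e u) s W) S ≟ 1)
  ; marked-once = from-yes (allVertices? λ u → total (λ s → tally isMarked u s W) S ≟ 1)
  ; closed      = from-yes (allVertices? λ s → ≡-dec Bool._≟_ (end s W) s)
  ; simple      = from-yes (allVertices? λ u → tally always u (Vec.replicate 4 false) W ≤? 1)
  }
  where
  S : List (Vertex 4)
  S = (false ∷ false ∷ false ∷ false ∷ []) ∷ (true ∷ true ∷ true ∷ false ∷ []) ∷ []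
  R W : List (Step 4)
  R = (true , 1F) ∷ (true , 0F) ∷ (true , 2F) ∷ (false , 3F) ∷ (true , 0F) ∷ (true , 3F) ∷ (false , 1F)
    ∷ (false , 3F) ∷ (true , 2F) ∷ (false , 1F) ∷ (true , 0F) ∷ (false , 1F) ∷ (false , 2F) ∷ (false , 3F)
    ∷ (false , 2F) ∷ []
  W = (true , 0F) ∷ R

-- From counting conditions to a decomposition into cycles.

term≤∑ : ∀ (f : Fin n → ℕ) i → f i ≤ ∑ f
term≤∑ f zero    = m≤m+n (f zero) _
term≤∑ f (suc i) = ≤-trans (term≤∑ (f ∘ suc) i) (m≤n+m _ (f zero))

∑-positive : ∀ (f : Fin n → ℕ) → 1 ≤ ∑ f → ∃ λ i → 1 ≤ f i
∑-positive {suc n} f h with f zero in e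
... | suc _ = zero , ≤-trans (s≤s z≤n) (≤-reflexive (sym e))
... | zero  = let i , p = ∑-positive (f ∘ suc) h in suc i , p

∑-unique : ∀ (f : Fin n → ℕ) → ∑ f ≤ 1 → ∀ i j → 1 ≤ f i → 1 ≤ f j → i ≡ j
∑-unique f h zero    zero    p q = refl
∑-unique f h zero    (suc j) p q =
  contradiction (≤-trans (+-mono-≤ p (≤-trans q (term≤∑ (f ∘ suc) j))) h) λ { (s≤s ()) }
∑-unique f h (suc i) zero    p q =
  contradiction (≤-trans (+-mono-≤ q (≤-trans p (term≤∑ (f ∘ suc) i))) h) λ { (s≤s ()) }
∑-unique f h (suc i) (suc j) p q = cong suc (∑-unique (f ∘ suc) (≤-trans (m≤n+m _ (f zero)) h) i j p q)

total-∑ : ∀ (f : A → ℕ) S → total f S ≡ ∑ (λ i → f (lookup S i))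
total-∑ f []      = refl
total-∑ f (x ∷ S) = cong (f x +_) (total-∑ f S)

visit : Vertex n → (T : List (Step n)) → Fin (length T) → Vertex n
visit s (t ∷ T) zero    = s
visit s (t ∷ T) (suc j) = visit (flip (proj₂ t) s) T j

direction : (T : List (Step n)) → Fin (length T) → Fin n
direction T j = proj₂ (lookup T j)

tally-∑ : ∀ (g : Step n → ℕ) u s T → tally g u s T ≡ ∑ (λ j → δ u (visit s T j) * g (lookup T j))
tally-∑ g u s []      = refl
tally-∑ g u s (t ∷ T) = cong (δ u s * g t +_) (tally-∑ g u (flip (proj₂ t) s) T)

visit-take : ∀ (s : Vertex n) T j → visit s T j ≡ end s (take (toℕ j) T)
visit-take s (t ∷ T) zero    = refl
visit-take s (t ∷ T) (suc j) = visit-take (flip (proj₂ t) s) T j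

end-take-suc : ∀ (s : Vertex n) T j → end s (take (suc (toℕ j)) T) ≡ flip (direction T j) (visit s T j)
end-take-suc s (t ∷ T) zero    = refl
end-take-suc s (t ∷ T) (suc j) = end-take-suc (flip (proj₂ t) s) T j

toℕ-cnext : ∀ {k} (j : Fin (suc k)) → toℕ (cnext j) ≡ suc (toℕ j) % suc k
toℕ-cnext {k} j = toℕ-fromℕ< (m%n<n (suc (toℕ j)) (suc k))

visit-cnext : ∀ (s : Vertex n) T → end s T ≡ s → ∀ j →
              visit s T (cnext j) ≡ flip (direction T j) (visit s T j)
visit-cnext s T@(_ ∷ T′) closed j =
  trans (visit-take s T (cnext j)) (trans wrap (end-take-suc s T j))
  where
  wrap : end s (take (toℕ (cnext j)) T) ≡ end s (take (suc (toℕ j)) T)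
  wrap with m≤n⇒m<n∨m≡n (toℕ<n j)
  ... | inj₁ j<k = cong (λ i → end s (take i T)) (trans (toℕ-cnext j) (m<n⇒m%n≡m j<k))
  -- At the last index `cnext` returns to 0, and closedness identifies the end of the whole walk
  -- with its start.
  ... | inj₂ j≡k = trans
    (cong (λ i → end s (take i T)) (trans (toℕ-cnext j) (trans (cong (_% length T) j≡k) (n%n≡0 (length T)))))
    (trans (sym closed) (cong (end s) (sym (take-all (suc (toℕ j)) T (≤-reflexive (sym j≡k))))))

δ-refl : (u : Vertex n) → δ u u ≡ 1
δ-refl []          = refl
δ-refl (false ∷ u) = trans (*-identityˡ (δ u u)) (δ-refl u)
δ-refl (true  ∷ u) = trans (*-identityˡ (δ u u)) (δ-refl u)

δ-positive : (u v : Vertex n) → 1 ≤ δ u v → u ≡ v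
δ-positive []          []          p = refl
δ-positive (false ∷ u) (false ∷ v) p = cong (false ∷_) (δ-positive u v (≤-trans p (≤-reflexive (*-identityˡ _))))
δ-positive (true  ∷ u) (true  ∷ v) p = cong (true ∷_) (δ-positive u v (≤-trans p (≤-reflexive (*-identityˡ _))))

δF-refl : (i : Fin n) → δF i i ≡ 1
δF-refl zero    = refl
δF-refl (suc i) = δF-refl i

δF-positive : (i j : Fin n) → 1 ≤ δF i j → i ≡ j
δF-positive zero    zero    p = refl
δF-positive (suc i) (suc j) p = cong suc (δF-positive i j p)

hamming-refl : (v : Vertex n) → hamming v v ≡ 0
hamming-refl []          = refl
hamming-refl (false ∷ v) = hamming-refl v
hamming-refl (true  ∷ v) = hamming-refl v

hamming≡0⇒≡ : (u v : Vertex n) → hamming u v ≡ 0 → u ≡ v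
hamming≡0⇒≡ []          []          h = refl
hamming≡0⇒≡ (false ∷ u) (false ∷ v) h = cong (false ∷_) (hamming≡0⇒≡ u v h)
hamming≡0⇒≡ (true  ∷ u) (true  ∷ v) h = cong (true ∷_) (hamming≡0⇒≡ u v h)

adjacent-flip : (d : Fin n) (v : Vertex n) → Adjacent v (flip d v)
adjacent-flip zero    (false ∷ v) = cong suc (hamming-refl v)
adjacent-flip zero    (true  ∷ v) = cong suc (hamming-refl v)
adjacent-flip (suc d) (false ∷ v) = adjacent-flip d v
adjacent-flip (suc d) (true  ∷ v) = adjacent-flip d v

adjacent⇒flip : (u v : Vertex n) → Adjacent u v → ∃ λ d → v ≡ flip d u
adjacent⇒flip []          []          ()
adjacent⇒flip (false ∷ u) (false ∷ v) h = let d , e = adjacent⇒flip u v h in suc d , cong (false ∷_) e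
adjacent⇒flip (true  ∷ u) (true  ∷ v) h = let d , e = adjacent⇒flip u v h in suc d , cong (true ∷_) e
adjacent⇒flip (false ∷ u) (true  ∷ v) h = zero , cong (true ∷_) (sym (hamming≡0⇒≡ u v (suc-injective h)))
adjacent⇒flip (true  ∷ u) (false ∷ v) h = zero , cong (false ∷_) (sym (hamming≡0⇒≡ u v (suc-injective h)))

flip-injective : (d e : Fin n) (v : Vertex n) → flip d v ≡ flip e v → d ≡ e
flip-injective zero    zero    v           h = refl
flip-injective zero    (suc e) (false ∷ v) ()
flip-injective zero    (suc e) (true  ∷ v) ()
flip-injective (suc d) zero    (false ∷ v) ()
flip-injective (suc d) zero    (true  ∷ v) ()
flip-injective (suc d) (suc e) (x ∷ v)     h = cong suc (flip-injective d e v (∷-injectiveʳ h))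

_⊕_ : Vertex n → Vertex n → Vertex n
_⊕_ = Vec.zipWith _xor_

⊕-cancelˡ : (s u v : Vertex n) → s ⊕ u ≡ s ⊕ v → u ≡ v
⊕-cancelˡ []          []      []      h = refl
⊕-cancelˡ (false ∷ s) (x ∷ u) (y ∷ v) h = cong₂ _∷_ (∷-injectiveˡ h) (⊕-cancelˡ s u v (∷-injectiveʳ h))
⊕-cancelˡ (true  ∷ s) (x ∷ u) (y ∷ v) h =
  cong₂ _∷_ (not-injective (∷-injectiveˡ h)) (⊕-cancelˡ s u v (∷-injectiveʳ h))

⊕-origin : (s : Vertex n) → s ⊕ Vec.replicate n false ≡ s
⊕-origin []          = refl
⊕-origin (false ∷ s) = cong (false ∷_) (⊕-origin s)
⊕-origin (true  ∷ s) = cong (true ∷_) (⊕-origin s)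

flip-⊕ : (d : Fin n) (s v : Vertex n) → flip d (s ⊕ v) ≡ s ⊕ flip d v
flip-⊕ zero    (false ∷ s) (x ∷ v) = refl
flip-⊕ zero    (true  ∷ s) (x ∷ v) = refl
flip-⊕ (suc d) (x ∷ s)     (y ∷ v) = cong ((x xor y) ∷_) (flip-⊕ d s v)

visit-⊕ : ∀ (s v : Vertex n) T j → visit (s ⊕ v) T j ≡ s ⊕ visit v T j
visit-⊕ s v (t ∷ T) zero    = refl
visit-⊕ s v (t ∷ T) (suc j) =
  trans (cong (λ w → visit w T j) (flip-⊕ (proj₂ t) s v)) (visit-⊕ s (flip (proj₂ t) v) T j)

-- Translation by `s` commutes with flips, so a repetition in the walk from `s` is one in the walk
-- from the origin, where two indices would raise a tally above 1.
visit-injective : ∀ (T : List (Step n)) → (∀ u → tally always u (Vec.replicate n false) T ≤ 1) →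
                  ∀ s {i j} → visit s T i ≡ visit s T j → i ≡ j
visit-injective {n} T simple s {i} {j} h =
  ∑-unique (λ l → δ (visit o T i) (visit o T l) * 1)
           (≤-trans (≤-reflexive (sym (tally-∑ always (visit o T i) o T))) (simple (visit o T i)))
           i j (hit (visit o T i) (visit o T i) refl) (hit (visit o T i) (visit o T j) same)
  where
  o = Vec.replicate n false
  same : visit o T i ≡ visit o T j
  same = ⊕-cancelˡ s _ _
    (trans (sym (visit-⊕ s o T i))
      (trans (trans (cong (λ v → visit v T i) (⊕-origin s)) (trans h (cong (λ v → visit v T j) (sym (⊕-origin s)))))
             (visit-⊕ s o T j)))
  hit : ∀ (u v : Vertex n) → u ≡ v → 1 ≤ δ u v * 1
  hit u _ refl = ≤-reflexive (sym (trans (*-identityʳ (δ u u)) (δ-refl u)))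

module Decompose {m n} (tour : Tour m n) (3≤L : 3 ≤ length (Tour.walk tour)) where
  open Tour tour

  L : ℕ
  L = length walk

  at : Fin (length starts) → Fin L → Vertex n
  at i = visit (lookup starts i) walk

  at-cnext : ∀ i j → at i (cnext j) ≡ flip (direction walk j) (at i j)
  at-cnext i = visit-cnext (lookup starts i) walk (closed (lookup starts i))

  cycle : Fin (length starts) → Cycle n L
  cycle i = record
    { length≥3 = 3≤L
    ; vert     = at i
    ; distinct = visit-injective walk simple (lookup starts i)
    ; adjacent = λ j → subst (Adjacent (at i j)) (sym (at-cnext i j)) (adjacent-flip (direction walk j) (at i j))
    }

  -- Indicator of step `j` of cycle `i` being the edge from `u` in direction `d`; the summands are
  -- the two senses of traversal. That its double sum is 1 gives both existence and uniqueness.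
  uses : Vertex n → Fin n → Fin (length starts) → Fin L → ℕ
  uses u d i j = δ u (at i j) * dirIs d (lookup walk j) + δ (flip d u) (at i j) * dirIs d (lookup walk j)

  ∑-uses : ∀ u d → ∑ (λ i → ∑ (uses u d i)) ≡ 1
  ∑-uses u d = begin-equality
    ∑ (λ i → ∑ (uses u d i))
      ≡⟨ sum-cong-≗ (λ i → trans (∑-distrib-+ (λ j → δ u (at i j) * dirIs d (lookup walk j))
                                       (λ j → δ (flip d u) (at i j) * dirIs d (lookup walk j)))
           (cong₂ _+_ (sym (tally-∑ (dirIs d) u (lookup starts i) walk))
                      (sym (tally-∑ (dirIs d) (flip d u) (lookup starts i) walk)))) ⟩
    ∑ (λ i → tally (dirIs d) u (lookup starts i) walk + tally (dirIs d) (flip d u) (lookup starts i) walk)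
      ≡⟨ sym (total-∑ (λ s → tally (dirIs d) u s walk + tally (dirIs d) (flip d u) s walk) starts) ⟩
    total (λ s → tally (dirIs d) u s walk + tally (dirIs d) (flip d u) s walk) starts
      ≡⟨ total-+ (λ s → tally (dirIs d) u s walk) _ starts ⟩
    total (λ s → tally (dirIs d) u s walk) starts + total (λ s → tally (dirIs d) (flip d u) s walk) starts
      ≡⟨ edges-once u d ⟩
    1 ∎

  uses⇒edge : ∀ u d i j → 1 ≤ uses u d i j → EdgeAt (cycle i) j u (flip d u)
  uses⇒edge u d i j p with direction walk j | at-cnext i j | δF-positive d (direction walk j) same
    where
    same : 1 ≤ δF d (direction walk j)
    same with δF d (direction walk j)
    ... | suc _ = s≤s z≤n
    ... | zero  = ≤-trans p (≤-reflexive (cong₂ _+_ (*-zeroʳ (δ u (at i j))) (*-zeroʳ (δ (flip d u) (at i j)))))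
  ... | .d | next | refl with δ u (at i j) in e | δ (flip d u) (at i j) in e′
  ... | suc _ | _     =
    let u≡at = δ-positive u (at i j) (≤-trans (s≤s z≤n) (≤-reflexive (sym e)))
    in inj₁ (sym u≡at , trans next (cong (flip d) (sym u≡at)))
  ... | zero  | suc _ =
    let fu≡at = δ-positive (flip d u) (at i j) (≤-trans (s≤s z≤n) (≤-reflexive (sym e′)))
    in inj₂ (sym fu≡at , trans next (trans (cong (flip d) (sym fu≡at)) (flip-involutive d u)))
  ... | zero  | zero  = contradiction p λ ()

  edge⇒uses : ∀ u v i j → EdgeAt (cycle i) j u v → v ≡ flip (direction walk j) u × 1 ≤ uses u (direction walk j) i j
  edge⇒uses u v i j (inj₁ (refl , refl)) =
    at-cnext i j ,
    ≤-trans (≤-reflexive (sym (cong₂ _*_ (δ-refl (at i j)) (δF-refl (direction walk j))))) (m≤m+n _ _)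
  edge⇒uses u v i j (inj₂ (refl , refl)) =
    sym back ,
    ≤-trans (≤-reflexive (sym (cong₂ _*_ (trans (cong (λ w → δ w (at i j)) back) (δ-refl (at i j)))
                                         (δF-refl (direction walk j)))))
            (m≤n+m _ _)
    where
    back : flip (direction walk j) (at i (cnext j)) ≡ at i j
    back = trans (cong (flip (direction walk j)) (at-cnext i j)) (flip-involutive (direction walk j) (at i j))

  uses-unique : ∀ u d i i′ j j′ → 1 ≤ uses u d i j → 1 ≤ uses u d i′ j′ → i ≡ i′ × j ≡ j′
  uses-unique u d i i′ j j′ p q with
    ∑-unique (λ i → ∑ (uses u d i)) (≤-reflexive (∑-uses u d)) i i′
      (≤-trans p (term≤∑ (uses u d i) j)) (≤-trans q (term≤∑ (uses u d i′) j′))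
  ... | refl = refl , ∑-unique (uses u d i)
    (≤-trans (term≤∑ (λ i → ∑ (uses u d i)) i) (≤-reflexive (∑-uses u d))) j j′ p q

  covered : ∀ u v → Adjacent u v → Σ (Fin (length starts)) λ i → Σ (Fin L) λ j → EdgeAt (cycle i) j u v
  covered u v adj with adjacent⇒flip u v adj
  ... | d , refl =
    let i , p = ∑-positive (λ i → ∑ (uses u d i)) (≤-reflexive (sym (∑-uses u d)))
        j , q = ∑-positive (uses u d i) p
    in i , j , uses⇒edge u d i j q

  unique-edge : ∀ u v i i′ j j′ → EdgeAt (cycle i) j u v → EdgeAt (cycle i′) j′ u v → i ≡ i′ × j ≡ j′
  unique-edge u v i i′ j j′ x y with edge⇒uses u v i j x | edge⇒uses u v i′ j′ y
  ... | e , p | e′ , q = uses-unique u (direction walk j) i i′ j j′ p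
    (subst (λ d → 1 ≤ uses u d i′ j′) (flip-injective _ _ u (trans (sym e′) e)) q)

  decomposition : Decomposition n L
  decomposition = record
    { t      = length starts
    ; cycles = cycle
    ; covers = covered
    ; unique = unique-edge
    }

-- Which pairs of exponent and dimension are reached.

tourLong : ∀ m k → Tour (suc m) (m * 4 + (2 + k * 2))
tourLong zero    k = Twice.tour k
tourLong (suc m) k = extend (tourLong m k)

tourShort : ∀ m → Tour (2 + m) (m * 4 + 4)
tourShort zero    = tour₂₄
tourShort (suc m) = extend (tourShort m)

2m≤2^m : ∀ m → m * 2 ≤ 2 ^ m
2m≤2^m zero                = z≤n
2m≤2^m (suc zero)          = ≤-refl
2m≤2^m (suc (suc m)) = begin
  2 + suc m * 2             ≤⟨ +-mono-≤ 2≤2^1+m (2m≤2^m (suc m)) ⟩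
  2 ^ suc m + 2 ^ suc m     ≡⟨ cong (2 ^ suc m +_) (sym (+-identityʳ (2 ^ suc m))) ⟩
  2 ^ suc (suc m)           ∎
  where
  2≤2^1+m : 2 ≤ 2 ^ suc m
  2≤2^1+m = ^-monoʳ-≤ 2 (s≤s {n = m} z≤n)

-- Descending from exponent `suc m` to 1 costs 4m dimensions, and 2m ≤ 2^m provides them. The even
-- remainder is either positive, the dimension of a double lap, or 0, and then the descent stops at
-- Q_4.
tourExists : ∀ m n → 1 ≤ m → 2 ∣ n → 2 ^ m ≤ n → Tour m n
tourExists (suc m) _ _ (divides q refl) 2^m≤n = fromQuotient (q ∸ m * 2) refl
  where
  2m≤q : m * 2 ≤ q
  2m≤q = *-cancelʳ-≤ (m * 2) q 2 (begin
    m * 2 * 2 ≤⟨ *-monoˡ-≤ 2 (2m≤2^m m) ⟩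
    2 ^ m * 2 ≡⟨ *-comm (2 ^ m) 2 ⟩
    2 ^ suc m ≤⟨ 2^m≤n ⟩
    q * 2     ∎)
  fromQuotient : ∀ k → q ∸ m * 2 ≡ k → Tour (suc m) (q * 2)
  fromQuotient (suc k) e = subst (Tour (suc m)) (trans (lemma m k) (cong (_* 2) split)) (tourLong m k)
    where
    split : m * 2 + suc k ≡ q
    split = trans (cong (m * 2 +_) (sym e)) (m+[n∸m]≡n 2m≤q)
    lemma : ∀ m k → m * 4 + (2 + k * 2) ≡ (m * 2 + (1 + k)) * 2
    lemma = solve-∀
  fromQuotient zero e = short m q (≤-antisym 2m≤q (m∸n≡0⇒m≤n e)) 2^m≤n
    where
    short : ∀ m q → m * 2 ≡ q → 2 ^ suc m ≤ q * 2 → Tour (suc m) (q * 2)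
    -- With exponent 1 the dimension would be 0, below 2^1.
    short zero    _ refl ()
    short (suc m) _ refl _  = subst (Tour (2 + m)) (lemma m) (tourShort m)
      where
      lemma : ∀ m → m * 4 + 4 ≡ (2 + m * 2) * 2
      lemma = solve-∀

theorem1p1 : ∀ (m n : ℕ) → 1 ≤ m → 2 ∣ n → 2 ^ m ≤ n →
    DecomposesIntoCycles n (2 ^ m * n)
theorem1p1 m n 1≤m 2∣n 2^m≤n =
  subst (Decomposition n) (Tour.length-walk tour)
    (Decompose.decomposition tour (≤-trans 3≤L (≤-reflexive (sym (Tour.length-walk tour)))))
  where
  tour : Tour m n
  tour = tourExists m n 1≤m 2∣n 2^m≤n
  2≤2^m : 2 ≤ 2 ^ m
  2≤2^m = ^-monoʳ-≤ 2 1≤m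
  3≤L : 3 ≤ 2 ^ m * n
  3≤L = ≤-trans (n≤1+n 3) (*-mono-≤ 2≤2^m (≤-trans 2≤2^m 2^m≤n))
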